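{- Consider the 26 hybrid vincular patterns of length 3 (defined in the context). Then: (i) $\underline{01}0$ and $\underline{01}1$ are Wilf equivalent, but not strongly Wilf equivalent; (ii) $\underline{10}0$ and $\underline{10}1$ are Wilf equivalent, but not strongly Wilf equivalent; (iii) $1\underline{01}$ and $1\underline{10}$ are strongly Wilf equivalent, but not super-strongly Wilf equivalent; (iv) $2\underline{01}$ and $2\underline{10}$ are Wilf equivalent, but not strongly Wilf equivalent. Moreover, these are the only generalized Wilf equivalences among hybrid vincular patterns of length 3: if $p\neq p'$ are hybrid vincular patterns of length 3 that are Wilf equivalent, then $\{p,p'\}$ is one of the four pairs listed in (i)–(iv).
   Context: An inversion sequence of length $n$ is a sequence $e=e_1e_2\dots e_n$ of integers with $0\le e_i<i$ for all $i$; $\mathbf{I}_n$ denotes the set of these. The reduction of an integer word $w$ is obtained by replacing every occurrence of the $i$th smallest value of $w$ by $i-1$, for all $i$. A hybrid vincular pattern of length 3 is a word $p=p_1p_2p_3$ with $p_i\in\{0,1,2\}$ such that any value $j>0$ appears only if $j-1$ appears, in which exactly one of the two adjacent pairs $p_1p_2$ or $p_2p_3$ is underlined (written $\underline{p_1p_2}p_3$ or $p_1\underline{p_2p_3}$). An occurrence of $p$ in $e\in\mathbf{I}_n$ is a set of positions $\{i_1<i_2<i_3\}$ such that the reduction of $e_{i_1}e_{i_2}e_{i_3}$ equals $p_1p_2p_3$, and additionally $i_2=i_1+1$ if $p_1p_2$ is underlined, resp. $i_3=i_2+1$ if $p_2p_3$ is underlined. Let $\mathrm{oc}(p,e)$ be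 the number of occurrences, $\mathbf{I}_n(p,m)=\{e\in\mathbf{I}_n:\mathrm{oc}(p,e)=m\}$ and $\mathbf{I}_n(p)=\mathbf{I}_n(p,0)$. For $S$ a set of 3-element subsets of $[n]$, let $\mathbf{I}_n(p,S)$ be the set of $e\in\mathbf{I}_n$ whose set of occurrences of $p$ (as position sets) is exactly $S$. Patterns $p,p'$ are Wilf equivalent if $|\mathbf{I}_n(p)|=|\mathbf{I}_n(p')|$ for all $n$; strongly Wilf equivalent if $|\mathbf{I}_n(p,m)|=|\mathbf{I}_n(p',m)|$ for all $n,m$; super-strongly Wilf equivalent if $|\mathbf{I}_n(p,S)|=|\mathbf{I}_n(p',S)|$ for all $n$ and all sets $S$ of 3-element subsets of $[n]$. A generalized Wilf equivalence means an equivalence of any of these three types. -}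

module Defs where

open import Data.Nat using (ℕ; zero; suc; _≤_; _<_; _<?_; _≟_)
open import Data.Bool using (Bool; true; false; _∧_; if_then_else_)
open import Data.List using (List; []; _∷_; _++_; [_]; map; filter; length; concatMap; upTo; deduplicate; filterᵇ; foldr)
open import Data.List.Properties using (≡-dec)
open import Data.Product using (_×_; _,_)
open import Data.Sum using (_⊎_)
open import Relation.Nullary using (does)
open import Relation.Binary.PropositionalEquality using (_≡_)

-- Inversion sequences, as lists of naturals (positions 0-indexed here:
-- the entry at 0-based position i, i.e. e_{i+1}, satisfies e_{i+1} < i+1).

-- allInv n enumerates I_n (each element exactly once): extend every
-- sequence of length n by a last entry e_{n+1} ∈ {0,…,n}.
allInv : ℕ → List (List ℕ)
allInv zero    = [] ∷ []
allInv (suc n) = concatMap (λ e → map (λ x → e ++ [ x ]) (upTo (suc n))) (allInv n)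

-- entry at a 0-based position (default 0 outside the range; only used
-- in range)
at : List ℕ → ℕ → ℕ
at []       _       = 0
at (x ∷ xs) zero    = x
at (x ∷ xs) (suc i) = at xs i

-- Reduction of a word: each letter x is replaced by the number of
-- distinct values of w strictly below x (i.e. the i-th smallest value
-- becomes i-1).
reduction : List ℕ → List ℕ
reduction w = map (λ x → length (deduplicate _≟_ (filter (_<? x) w))) w

-- left  : p₁p₂ underlined ( _p₁p₂_ p₃ );  right : p₂p₃ underlined.
data Side : Set where
  left right : Side

record HVPattern : Set where
  constructor hvp
  field
    p₁ p₂ p₃ : ℕ
    side     : Side
open HVPattern public

word : HVPattern → List ℕ
word p = p₁ p ∷ p₂ p ∷ p₃ p ∷ []

Appears : ℕ → HVPattern → Set
Appears j p = (p₁ p ≡ j) ⊎ (p₂ p ≡ j) ⊎ (p₃ p ≡ j)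

-- letters in {0,1,2}, and a value j>0 appears only if j-1 appears
-- (there are exactly 13 valid words, hence 26 valid patterns)
Valid : HVPattern → Set
Valid p = (p₁ p ≤ 2 × p₂ p ≤ 2 × p₃ p ≤ 2)
        × (∀ j → Appears (suc j) p → Appears j p)

Triple : Set
Triple = ℕ × ℕ × ℕ

triples : ℕ → List Triple
triples n = concatMap (λ k → concatMap (λ j → map (λ i → (i , j , k)) (upTo j)) (upTo k)) (upTo n)

adjacent : Side → Triple → Bool
adjacent left  (i , j , k) = does (j ≟ suc i)
adjacent right (i , j , k) = does (k ≟ suc j)

isOcc : HVPattern → List ℕ → Triple → Bool
isOcc p e (i , j , k) =
  does (≡-dec _≟_ (reduction (at e i ∷ at e j ∷ at e k ∷ [])) (word p))
  ∧ adjacent (side p) (i , j , k)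

oc : HVPattern → List ℕ → ℕ
oc p e = length (filterᵇ (λ t → isOcc p e t) (triples (length e)))

count : HVPattern → ℕ → ℕ → ℕ
count p n m = length (filterᵇ (λ e → does (oc p e ≟ m)) (allInv n))

-- A set S of 3-element subsets of [n] is given by its characteristic
-- function on triples i₁<i₂<i₃ (only its values on triples (triples n) matter).
_⇔ᵇ_ : Bool → Bool → Bool
true  ⇔ᵇ b = b
false ⇔ᵇ true  = false
false ⇔ᵇ false = true

allᵇ : {A : Set} → (A → Bool) → List A → Bool
allᵇ f = foldr (λ x b → f x ∧ b) true

occSetIs : HVPattern → List ℕ → (Triple → Bool) → Bool
occSetIs p e S = allᵇ (λ t → isOcc p e t ⇔ᵇ S t) (triples (length e))

countS : HVPattern → ℕ → (Triple → Bool) → ℕ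
countS p n S = length (filterᵇ (λ e → occSetIs p e S) (allInv n))

WilfEq : HVPattern → HVPattern → Set
WilfEq p q = ∀ n → count p n 0 ≡ count q n 0

StronglyWilfEq : HVPattern → HVPattern → Set
StronglyWilfEq p q = ∀ n m → count p n m ≡ count q n m

SuperStronglyWilfEq : HVPattern → HVPattern → Set
SuperStronglyWilfEq p q = ∀ n (S : Triple → Bool) → countS p n S ≡ countS q n S

u01-0 u01-1 u10-0 u10-1 1-u01 1-u10 2-u01 2-u10 : HVPattern
u01-0 = hvp 0 1 0 left
u01-1 = hvp 0 1 1 left
u10-0 = hvp 1 0 0 left
u10-1 = hvp 1 0 1 left
1-u01 = hvp 1 0 1 right
1-u10 = hvp 1 1 0 right
2-u01 = hvp 2 0 1 right
2-u10 = hvp 2 1 0 right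

SamePair : HVPattern → HVPattern → HVPattern → HVPattern → Set
SamePair p q a b = (p ≡ a × q ≡ b) ⊎ (p ≡ b × q ≡ a)

{-# OPTIONS --safe #-}

-- Avoiders of 01-0 and 01-1 (first two letters adjacent) grow by the same rule: if a values are allowed as
-- next letter and b of them are at most the last letter, choosing the (t+1)-st allowed value leads to
-- (a + 1 , t + 1) when t < b and to (a , t) otherwise, because an ascent forbids exactly one of its two
-- letters. For 10-0 and 10-1 the same holds with descents. For 2-01 and 2-10 the state is the maximum
-- together with the number of allowed letters below it.
--
-- For 1-01 and 1-10, the word has weight q ^ oc. In 1-01 each ascent l x contributes q ^ c, in 1-10 each
-- descent x l, with c the number of earlier copies of the larger letter x. Writing q ^ c = 1 + (q ^ c - 1)
-- and marking the pairs where the second summand is taken cuts the word into marked runs, increasing in one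
-- case and decreasing in the other. Reversing a run changes neither its weight nor the later counts, and it
-- keeps the inversion sequence condition since marked letters (c > 0) are never first copies.

module Submission where

open import Defs
open import Algebra.Properties.CommutativeSemigroup using (interchange; x∙yz≈y∙xz)
open import Data.Bool using (Bool; true; false; _∧_; _∨_; if_then_else_; not)
open import Data.Bool.Properties using (∧-identityʳ; ∧-zeroʳ; ∨-identityʳ)
open import Data.List using (List; []; _∷_; _++_; [_]; map; filter; length; concatMap; upTo; filterᵇ; reverse; deduplicate; cartesianProductWith)
open import Data.List.Membership.Propositional using (_∈_)
open import Data.List.Membership.Propositional.Properties using (∈-cartesianProductWith⁺; ∈-filter⁺; ∈-upTo⁺)
open import Data.List.Properties using (≡-dec; map-++; upTo-∷ʳ; length-reverse; length-map; unfold-reverse; map-cong)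
open import Data.List.Relation.Binary.Permutation.Propositional using (_↭_; prep; swap; ↭-refl)
import Data.List.Relation.Binary.Permutation.Propositional as Perm
open import Data.List.Relation.Binary.Permutation.Propositional.Properties using (map⁺; ↭-length)
open import Data.List.Relation.Unary.Any using (here; there)
open import Data.Nat using (ℕ; zero; suc; _+_; _*_; _∸_; _^_; _≤_; _<_; _⊔_; _≟_; _<?_; _≡ᵇ_; _<ᵇ_; z≤n; s≤s)
open import Data.Nat.DivMod using (_%_; [m+kn]%n≡m%n; m<n⇒m%n≡m)
open import Data.Nat.ListAction using (sum)
open import Data.Nat.ListAction.Properties using (sum-++; sum-↭)
open import Data.Nat.Properties hiding (_≟_; _<?_)
open import Data.Product using (_×_; _,_; proj₁)
open import Data.Sum using (_⊎_; inj₁; inj₂)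
open import Data.Unit using (⊤; tt)
open import Function using (_∘_)
open import Relation.Binary using (tri<; tri≈; tri>)
open import Relation.Binary.PropositionalEquality using (_≡_; _≢_; refl; sym; trans; cong; cong₂; subst; module ≡-Reasoning)
open import Relation.Nullary using (¬_; Dec; does; yes; no; contradiction)
open import Relation.Nullary.Decidable using (map′; _×-dec_; _⊎-dec_; _→-dec_)
open import Relation.Unary using (Decidable)
open ≡-Reasoning

-- Finite sums over initial segments and over lists.

bit : Bool → ℕ
bit true  = 1
bit false = 0

∑< : ℕ → (ℕ → ℕ) → ℕ
∑< zero    f = 0
∑< (suc n) f = ∑< n f + f n

syntax ∑< n (λ x → e) = ∑[ x < n ] e

∑-cong : ∀ n {f g : ℕ → ℕ} → (∀ x → x < n → f x ≡ g x) → ∑< n f ≡ ∑< n g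
∑-cong zero    h = refl
∑-cong (suc n) h = cong₂ _+_ (∑-cong n (λ x x<n → h x (m<n⇒m<1+n x<n))) (h n ≤-refl)

∑-zero : ∀ n {f : ℕ → ℕ} → (∀ x → x < n → f x ≡ 0) → ∑< n f ≡ 0
∑-zero zero    h = refl
∑-zero (suc n) h = cong₂ _+_ (∑-zero n (λ x x<n → h x (m<n⇒m<1+n x<n))) (h n ≤-refl)

∑-+ : ∀ n (f g : ℕ → ℕ) → ∑[ x < n ] (f x + g x) ≡ ∑< n f + ∑< n g
∑-+ zero    f g = refl
∑-+ (suc n) f g = trans (cong (_+ (f n + g n)) (∑-+ n f g)) (interchange +-commutativeSemigroup (∑< n f) (∑< n g) (f n) (g n))

∑-*ˡ : ∀ n c (f : ℕ → ℕ) → ∑[ x < n ] (c * f x) ≡ c * ∑< n f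
∑-*ˡ zero    c f = sym (*-zeroʳ c)
∑-*ˡ (suc n) c f = trans (cong (_+ c * f n) (∑-*ˡ n c f)) (sym (*-distribˡ-+ c (∑< n f) (f n)))

∑-split : ∀ m k (f : ℕ → ℕ) → ∑< (m + k) f ≡ ∑< m f + ∑[ i < k ] f (m + i)
∑-split m zero    f = trans (cong (λ z → ∑< z f) (+-identityʳ m)) (sym (+-identityʳ _))
∑-split m (suc k) f rewrite +-suc m k | ∑-split m k f = +-assoc (∑< m f) _ _

∑∈ : ∀ {A : Set} → List A → (A → ℕ) → ℕ
∑∈ xs f = sum (map f xs)

module _ {A : Set} where
  ∑∈-cong : ∀ (xs : List A) {f g : A → ℕ} → (∀ x → f x ≡ g x) → ∑∈ xs f ≡ ∑∈ xs g
  ∑∈-cong xs h = cong sum (map-cong h xs)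

  ∑∈-++ : ∀ (xs ys : List A) f → ∑∈ (xs ++ ys) f ≡ ∑∈ xs f + ∑∈ ys f
  ∑∈-++ xs ys f = trans (cong sum (map-++ f xs ys)) (sum-++ (map f xs) (map f ys))

  length-filterᵇ : ∀ (p : A → Bool) xs → length (filterᵇ p xs) ≡ ∑∈ xs (bit ∘ p)
  length-filterᵇ p []       = refl
  length-filterᵇ p (x ∷ xs) with p x
  ... | true  = cong suc (length-filterᵇ p xs)
  ... | false = length-filterᵇ p xs

∑∈-map : ∀ {A B : Set} (g : A → B) xs f → ∑∈ (map g xs) f ≡ ∑∈ xs (f ∘ g)
∑∈-map g []       f = refl
∑∈-map g (x ∷ xs) f = cong (f (g x) +_) (∑∈-map g xs f)

∑∈-concatMap : ∀ {A B : Set} (g : A → List B) xs f → ∑∈ (concatMap g xs) f ≡ ∑∈ xs (λ x → ∑∈ (g x) f)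
∑∈-concatMap g []       f = refl
∑∈-concatMap g (x ∷ xs) f = trans (∑∈-++ (g x) (concatMap g xs) f) (cong (∑∈ (g x) f +_) (∑∈-concatMap g xs f))

∑∈-upTo : ∀ n f → ∑∈ (upTo n) f ≡ ∑< n f
∑∈-upTo zero    f = refl
∑∈-upTo (suc n) f = begin
  ∑∈ (upTo (suc n)) f       ≡⟨ cong (λ xs → ∑∈ xs f) (sym (upTo-∷ʳ n)) ⟩
  ∑∈ (upTo n ++ [ n ]) f    ≡⟨ ∑∈-++ (upTo n) [ n ] f ⟩
  ∑∈ (upTo n) f + (f n + 0) ≡⟨ cong₂ _+_ (∑∈-upTo n f) (+-identityʳ (f n)) ⟩
  ∑< n f + f n              ∎

-- Enumeration of inversion sequences letter by letter.

-- From here on a word, usually called r, is stored with its last letter at the head.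
total : ℕ → (List ℕ → ℕ) → List ℕ → ℕ
total zero    f r = f r
total (suc k) f r = ∑[ x < suc (length r) ] total k f (x ∷ r)

total-cong : ∀ k {f g : List ℕ → ℕ} → (∀ r → f r ≡ g r) → ∀ r → total k f r ≡ total k g r
total-cong zero    h r = h r
total-cong (suc k) h r = ∑-cong (suc (length r)) (λ x _ → total-cong k h (x ∷ r))

-- `total` recurses on the first appended letter, `allInv` on the last one; this moves the last
-- choice to the inside, so that the two recursions can be matched.
total-snoc : ∀ k f r → total (suc k) f r ≡ total k (λ r → ∑[ x < suc (length r) ] f (x ∷ r)) r
total-snoc zero    f r = refl
total-snoc (suc k) f r = ∑-cong (suc (length r)) (λ x _ → total-snoc k f (x ∷ r))

snoc-reverse : ∀ x (r : List ℕ) → reverse r ++ [ x ] ≡ reverse (x ∷ r)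
snoc-reverse x r = sym (unfold-reverse x r)

-- total only ever evaluates its argument on words of the final length.
total-cong-length : ∀ k {f g : List ℕ → ℕ} r → (∀ s → length s ≡ k + length r → f s ≡ g s) → total k f r ≡ total k g r
total-cong-length zero    r h = h r refl
total-cong-length (suc k) r h = ∑-cong (suc (length r))
  (λ x _ → total-cong-length k (x ∷ r) (λ s eq → h s (trans eq (+-suc k (length r)))))

∑-allInv : ∀ n f → ∑∈ (allInv n) f ≡ total n (f ∘ reverse) []
∑-allInv zero    f = +-identityʳ (f [])
∑-allInv (suc n) f = begin
  ∑∈ (allInv (suc n)) f
    ≡⟨ ∑∈-concatMap (λ e → map (λ x → e ++ [ x ]) (upTo (suc n))) (allInv n) f ⟩
  ∑∈ (allInv n) (λ e → ∑∈ (map (λ x → e ++ [ x ]) (upTo (suc n))) f)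
    ≡⟨ ∑∈-cong (allInv n) (λ e → trans (∑∈-map (λ x → e ++ [ x ]) (upTo (suc n)) f) (∑∈-upTo (suc n) (λ x → f (e ++ [ x ])))) ⟩
  ∑∈ (allInv n) (λ e → ∑[ x < suc n ] f (e ++ [ x ]))
    ≡⟨ ∑-allInv n _ ⟩
  total n (λ r → ∑[ x < suc n ] f (reverse r ++ [ x ])) []
    -- All words reached have length `n`, so the fixed range `suc n` becomes `suc (length r)`.
    ≡⟨ total-cong-length n [] (λ r eq → trans
         (∑-cong (suc n) (λ x _ → cong f (snoc-reverse x r)))
         (cong (λ l → ∑[ x < suc l ] f (reverse (x ∷ r))) (sym (trans eq (+-identityʳ n))))) ⟩
  total n (λ r → ∑[ x < suc (length r) ] f (reverse (x ∷ r))) []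
    ≡⟨ total-snoc n (f ∘ reverse) [] ⟨
  total (suc n) (f ∘ reverse) [] ∎

-- Occurrences grouped by their last letter.

match : HVPattern → ℕ → ℕ → ℕ → Bool
match p a b c = does (≡-dec _≟_ (reduction (a ∷ b ∷ c ∷ [])) (word p))

-- Occurrences whose third letter is the appended `x`. With the left pair underlined, two neighbours
-- range over the word; with the right pair underlined, the second letter must be the last letter
-- `l` and only the first one varies.
matchesˡ matchesʳ new : HVPattern → List ℕ → ℕ → ℕ
matchesˡ p []          x = 0
matchesˡ p (_ ∷ [])    x = 0
matchesˡ p (y ∷ l ∷ r) x = bit (match p l y x) + matchesˡ p (l ∷ r) x

matchesʳ p []      x = 0
matchesʳ p (l ∷ r) x = ∑∈ r (λ z → bit (match p z l x))

new p with side p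
... | left  = matchesˡ p
... | right = matchesʳ p

occ : HVPattern → List ℕ → ℕ
occ p []      = 0
occ p (x ∷ r) = occ p r + new p r x

at-++ˡ : ∀ e x i → i < length e → at (e ++ [ x ]) i ≡ at e i
at-++ˡ (y ∷ e) x zero    _       = refl
at-++ˡ (y ∷ e) x (suc i) (s≤s h) = at-++ˡ e x i h

at-++ʳ : ∀ e x → at (e ++ [ x ]) (length e) ≡ x
at-++ʳ []      x = refl
at-++ʳ (y ∷ e) x = at-++ʳ e x

at-reverse-head : ∀ x r → at (reverse (x ∷ r)) (length r) ≡ x
at-reverse-head x r = begin
  at (reverse (x ∷ r)) (length r)                ≡⟨ cong₂ at (unfold-reverse x r) (sym (length-reverse r)) ⟩
  at (reverse r ++ [ x ]) (length (reverse r))   ≡⟨ at-++ʳ (reverse r) x ⟩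
  x                                              ∎

at-reverse-tail : ∀ x r i → i < length r → at (reverse (x ∷ r)) i ≡ at (reverse r) i
at-reverse-tail x r i i<n = trans (cong (λ e → at e i) (unfold-reverse x r))
  (at-++ˡ (reverse r) x i (subst (i <_) (sym (length-reverse r)) i<n))

∑-triples : ∀ n f → ∑∈ (triples n) f ≡ ∑[ k < n ] ∑[ j < k ] ∑[ i < j ] f (i , j , k)
∑-triples n f = begin
  ∑∈ (triples n) f
    ≡⟨ trans (∑∈-concatMap _ (upTo n) f) (∑∈-upTo n _) ⟩
  ∑[ k < n ] ∑∈ (concatMap (λ j → map (λ i → (i , j , k)) (upTo j)) (upTo k)) f
    ≡⟨ ∑-cong n (λ k _ → trans (trans (∑∈-concatMap _ (upTo k) f) (∑∈-upTo k _))
         (∑-cong k (λ j _ → trans (∑∈-map _ (upTo j) f) (∑∈-upTo j _)))) ⟩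
  (∑[ k < n ] ∑[ j < k ] ∑[ i < j ] f (i , j , k)) ∎

≡ᵇ-refl : ∀ n → (n ≡ᵇ n) ≡ true
≡ᵇ-refl zero    = refl
≡ᵇ-refl (suc n) = ≡ᵇ-refl n

<⇒≢ᵇ : ∀ {m n} → m < n → (m ≡ᵇ n) ≡ false
<⇒≢ᵇ {zero}  {suc n} _       = refl
<⇒≢ᵇ {suc m} {suc n} (s≤s h) = <⇒≢ᵇ h

>⇒≢ᵇ : ∀ {m n} → n < m → (m ≡ᵇ n) ≡ false
>⇒≢ᵇ {suc m} {zero}  _       = refl
>⇒≢ᵇ {suc m} {suc n} (s≤s h) = >⇒≢ᵇ h

bit-∧-false : ∀ a {b} → b ≡ false → bit (a ∧ b) ≡ 0
bit-∧-false a refl = cong bit (∧-zeroʳ a)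

bit-∧-true : ∀ a {b} → b ≡ true → bit (a ∧ b) ≡ bit a
bit-∧-true true  refl = refl
bit-∧-true false refl = refl

oc-triples : ∀ p e → oc p e ≡ ∑[ k < length e ] ∑[ j < k ] ∑[ i < j ] bit (isOcc p e (i , j , k))
oc-triples p e = trans (length-filterᵇ (isOcc p e) (triples (length e))) (∑-triples (length e) _)

isOcc-snoc : ∀ p x r i j k → i < length r → j < length r → k < length r →
  isOcc p (reverse (x ∷ r)) (i , j , k) ≡ isOcc p (reverse r) (i , j , k)
isOcc-snoc p x r i j k hi hj hk
  rewrite at-reverse-tail x r i hi | at-reverse-tail x r j hj | at-reverse-tail x r k hk = refl

-- Adjacency with the final position leaves only the last `j`, and the remaining sum over `i` runs
-- through the letters before `l`.
ends-right : ∀ w₁ w₂ w₃ r x → let p = hvp w₁ w₂ w₃ right in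
  ∑[ j < length r ] ∑[ i < j ] bit (match p (at (reverse r) i) (at (reverse r) j) x ∧ (length r ≡ᵇ suc j)) ≡ matchesʳ p r x
ends-right w₁ w₂ w₃ []      x = refl
ends-right w₁ w₂ w₃ (l ∷ r) x = begin
  (∑[ j < length r ] ∑[ i < j ] bit (m i j ∧ (length r ≡ᵇ j))) +
    (∑[ i < length r ] bit (m i (length r) ∧ (length r ≡ᵇ length r)))
    ≡⟨ cong₂ _+_ (∑-zero (length r) (λ j j<n → ∑-zero j (λ i _ → bit-∧-false (m i j) (>⇒≢ᵇ j<n))))
                 (∑-cong (length r) (λ i i<n → trans (bit-∧-true (m i (length r)) (≡ᵇ-refl (length r)))
                   (cong₂ (λ a b → bit (match p a b x)) (at-reverse-tail l r i i<n) (at-reverse-head l r)))) ⟩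
  (∑[ i < length r ] bit (match p (at (reverse r) i) l x))
    ≡⟨ ∑-at-reverse (λ z → bit (match p z l x)) r ⟩
  ∑∈ r (λ z → bit (match p z l x)) ∎
  where
  p = hvp w₁ w₂ w₃ right
  m : ℕ → ℕ → Bool
  m i j = match p (at (reverse (l ∷ r)) i) (at (reverse (l ∷ r)) j) x
  ∑-at-reverse : ∀ (f : ℕ → ℕ) r → ∑[ i < length r ] f (at (reverse r) i) ≡ ∑∈ r f
  ∑-at-reverse f []      = refl
  ∑-at-reverse f (z ∷ r) = begin
    (∑[ i < length r ] f (at (reverse (z ∷ r)) i)) + f (at (reverse (z ∷ r)) (length r))
      ≡⟨ cong₂ _+_ (trans (∑-cong (length r) (λ i i<n → cong f (at-reverse-tail z r i i<n))) (∑-at-reverse f r))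
                   (cong f (at-reverse-head z r)) ⟩
    ∑∈ r f + f z ≡⟨ +-comm (∑∈ r f) (f z) ⟩
    f z + ∑∈ r f ∎

-- Induction on the word: a last letter `y` takes part as second letter only together with its
-- neighbour `l`; all other pairs already lie in the shorter word.
ends-left : ∀ w₁ w₂ w₃ r x → let p = hvp w₁ w₂ w₃ left in
  ∑[ j < length r ] ∑[ i < j ] bit (match p (at (reverse r) i) (at (reverse r) j) x ∧ (j ≡ᵇ suc i)) ≡ matchesˡ p r x
ends-left w₁ w₂ w₃ []          x = refl
ends-left w₁ w₂ w₃ (y ∷ [])    x = refl
ends-left w₁ w₂ w₃ (y ∷ l ∷ r) x = begin
  (∑[ j < suc n ] ∑[ i < j ] bit (m i j ∧ (j ≡ᵇ suc i))) +
  ((∑[ i < n ] bit (m i (suc n) ∧ (n ≡ᵇ i))) + bit (m n (suc n) ∧ (n ≡ᵇ n)))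
    ≡⟨ cong₂ _+_ (trans (∑-cong (suc n) (λ j j<n → ∑-cong j (λ i i<j → cong₂ (λ a b → bit (match p a b x ∧ (j ≡ᵇ suc i)))
                          (at-reverse-tail y (l ∷ r) i (<-trans i<j j<n)) (at-reverse-tail y (l ∷ r) j j<n))))
                   (ends-left w₁ w₂ w₃ (l ∷ r) x))
         (cong₂ _+_ (∑-zero n (λ i i<n → bit-∧-false (m i (suc n)) (>⇒≢ᵇ i<n)))
           (trans (bit-∧-true (m n (suc n)) (≡ᵇ-refl n))
             (cong₂ (λ a b → bit (match p a b x)) (trans (at-reverse-tail y (l ∷ r) n ≤-refl) (at-reverse-head l r))
                                                  (at-reverse-head y (l ∷ r))))) ⟩
  matchesˡ p (l ∷ r) x + bit (match p l y x)
    ≡⟨ +-comm (matchesˡ p (l ∷ r) x) _ ⟩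
  bit (match p l y x) + matchesˡ p (l ∷ r) x ∎
  where
  p = hvp w₁ w₂ w₃ left
  n = length r
  m : ℕ → ℕ → Bool
  m i j = match p (at (reverse (y ∷ l ∷ r)) i) (at (reverse (y ∷ l ∷ r)) j) x

ends-new : ∀ p r x →
  ∑[ j < length r ] ∑[ i < j ] bit (match p (at (reverse r) i) (at (reverse r) j) x ∧ adjacent (side p) (i , j , length r)) ≡ new p r x
ends-new (hvp a b c left)  r x = ends-left a b c r x
ends-new (hvp a b c right) r x = ends-right a b c r x

-- Triples are split by their third position: below `length r` they do not see the new letter, and
-- at `length r` they are counted by `new`.
oc-reverse : ∀ p r → oc p (reverse r) ≡ occ p r
oc-reverse p []      = refl
oc-reverse p (x ∷ r) = begin
  oc p (reverse (x ∷ r))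
    ≡⟨ oc-triples p (reverse (x ∷ r)) ⟩
  (∑[ k < length (reverse (x ∷ r)) ] ∑[ j < k ] ∑[ i < j ] bit (isOcc p (reverse (x ∷ r)) (i , j , k)))
    ≡⟨ cong (λ n → ∑[ k < n ] ∑[ j < k ] ∑[ i < j ] bit (isOcc p (reverse (x ∷ r)) (i , j , k))) (length-reverse (x ∷ r)) ⟩
  (∑[ k < n ] ∑[ j < k ] ∑[ i < j ] bit (isOcc p (reverse (x ∷ r)) (i , j , k))) +
  (∑[ j < n ] ∑[ i < j ] bit (isOcc p (reverse (x ∷ r)) (i , j , n)))
    ≡⟨ cong₂ _+_
        (∑-cong n (λ k k<n → ∑-cong k (λ j j<k → ∑-cong j (λ i i<j →
          cong bit (isOcc-snoc p x r i j k (<-trans i<j (<-trans j<k k<n)) (<-trans j<k k<n) k<n)))))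
        (∑-cong n (λ j j<n → ∑-cong j (λ i i<j → lastly i j i<j j<n))) ⟩
  (∑[ k < n ] ∑[ j < k ] ∑[ i < j ] bit (isOcc p (reverse r) (i , j , k))) +
  (∑[ j < n ] ∑[ i < j ] bit (match p (at (reverse r) i) (at (reverse r) j) x ∧ adjacent (side p) (i , j , n)))
    ≡⟨ cong₂ _+_ (trans (cong (λ n → ∑[ k < n ] ∑[ j < k ] ∑[ i < j ] bit (isOcc p (reverse r) (i , j , k))) (sym (length-reverse r)))
                   (trans (sym (oc-triples p (reverse r))) (oc-reverse p r)))
                 (ends-new p r x) ⟩
  occ p r + new p r x ∎
  where
  n = length r
  lastly : ∀ i j → i < j → j < n → bit (isOcc p (reverse (x ∷ r)) (i , j , n)) ≡
    bit (match p (at (reverse r) i) (at (reverse r) j) x ∧ adjacent (side p) (i , j , n))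
  lastly i j i<j j<n rewrite at-reverse-tail x r i (<-trans i<j j<n) | at-reverse-tail x r j j<n | at-reverse-head x r = refl

count-total : ∀ p n m → count p n m ≡ total n (λ r → bit (occ p r ≡ᵇ m)) []
count-total p n m = begin
  count p n m                                       ≡⟨ length-filterᵇ (λ e → does (oc p e ≟ m)) (allInv n) ⟩
  ∑∈ (allInv n) (λ e → bit (oc p e ≡ᵇ m))           ≡⟨ ∑-allInv n _ ⟩
  total n (λ r → bit (oc p (reverse r) ≡ᵇ m)) []    ≡⟨ total-cong n (λ r → cong (λ o → bit (o ≡ᵇ m)) (oc-reverse p r)) [] ⟩
  total n (λ r → bit (occ p r ≡ᵇ m)) []             ∎

-- Reduction of three letters in terms of their comparisons.

<⇒<ᵇ≡true : ∀ {m n} → m < n → (m <ᵇ n) ≡ true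
<⇒<ᵇ≡true {zero}  {suc n} _       = refl
<⇒<ᵇ≡true {suc m} {suc n} (s≤s h) = <⇒<ᵇ≡true h

≤⇒<ᵇ≡false : ∀ {m n} → n ≤ m → (m <ᵇ n) ≡ false
≤⇒<ᵇ≡false {m}     {zero}  _       = refl
≤⇒<ᵇ≡false {suc m} {suc n} (s≤s h) = ≤⇒<ᵇ≡false h

data Sgn : Set where
  LT EQ GT : Sgn

sgn : ℕ → ℕ → Sgn
sgn a b = if a <ᵇ b then LT else if b <ᵇ a then GT else EQ

-- A table for the reduction, indexed by the comparisons of first with second, second with third,
-- and first with third letter. The last is consulted only where the first two leave the order open.
ordered : Sgn → Sgn → Sgn → List ℕ
ordered LT LT _  = 0 ∷ 1 ∷ 2 ∷ []
ordered LT EQ _  = 0 ∷ 1 ∷ 1 ∷ []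
ordered LT GT LT = 0 ∷ 2 ∷ 1 ∷ []
ordered LT GT EQ = 0 ∷ 1 ∷ 0 ∷ []
ordered LT GT GT = 1 ∷ 2 ∷ 0 ∷ []
ordered EQ LT _  = 0 ∷ 0 ∷ 1 ∷ []
ordered EQ EQ _  = 0 ∷ 0 ∷ 0 ∷ []
ordered EQ GT _  = 1 ∷ 1 ∷ 0 ∷ []
ordered GT LT LT = 1 ∷ 0 ∷ 2 ∷ []
ordered GT LT EQ = 1 ∷ 0 ∷ 1 ∷ []
ordered GT LT GT = 2 ∷ 0 ∷ 1 ∷ []
ordered GT EQ _  = 1 ∷ 0 ∷ 0 ∷ []
ordered GT GT _  = 2 ∷ 1 ∷ 0 ∷ []

red : ℕ → ℕ → ℕ → List ℕ
red a b c = ordered (sgn a b) (sgn b c) (sgn a c)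

-- filter and deduplicate with all their tests exposed to rewriting: the library's
-- filter shows only the first one.
filterⁱ : (ℕ → Bool) → List ℕ → List ℕ
filterⁱ p []       = []
filterⁱ p (x ∷ xs) = if p x then x ∷ filterⁱ p xs else filterⁱ p xs

deduplicateⁱ : List ℕ → List ℕ
deduplicateⁱ []       = []
deduplicateⁱ (x ∷ xs) = x ∷ filterⁱ (λ y → not (x ≡ᵇ y)) (deduplicateⁱ xs)

filter≡filterⁱ : ∀ {P : ℕ → Set} (P? : Decidable P) xs → filter P? xs ≡ filterⁱ (λ x → does (P? x)) xs
filter≡filterⁱ P? []       = refl
filter≡filterⁱ P? (x ∷ xs) with does (P? x)
... | true  = cong (x ∷_) (filter≡filterⁱ P? xs)
... | false = filter≡filterⁱ P? xs

deduplicate≡deduplicateⁱ : ∀ xs → deduplicate _≟_ xs ≡ deduplicateⁱ xs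
deduplicate≡deduplicateⁱ []       = refl
deduplicate≡deduplicateⁱ (x ∷ xs) = cong (x ∷_) (trans (filter≡filterⁱ _ (deduplicate _≟_ xs))
  (cong (filterⁱ (λ y → not (x ≡ᵇ y))) (deduplicate≡deduplicateⁱ xs)))

reductionⁱ : List ℕ → List ℕ
reductionⁱ w = map (λ x → length (deduplicateⁱ (filterⁱ (_<ᵇ x) w))) w

reduction≡reductionⁱ : ∀ w → reduction w ≡ reductionⁱ w
reduction≡reductionⁱ w = map-cong (λ x → cong length (trans (deduplicate≡deduplicateⁱ (filter (_<? x) w))
  (cong deduplicateⁱ (filter≡filterⁱ (_<? x) w)))) w

-- Once the relative order is fixed, every test on either side rewrites to a Boolean constant and
-- both sides compute to the same word.
reductionⁱ≡red : ∀ a b c → reductionⁱ (a ∷ b ∷ c ∷ []) ≡ red a b c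
reductionⁱ≡red a b c with <-cmp a b | <-cmp b c | <-cmp a c
... | tri< a<b _ _ | tri< b<c _ _ | _
  rewrite ≤⇒<ᵇ≡false (≤-refl {a}) | ≤⇒<ᵇ≡false (≤-refl {b}) | ≤⇒<ᵇ≡false (≤-refl {c}) | <⇒<ᵇ≡true a<b
  | ≤⇒<ᵇ≡false (<⇒≤ a<b) | <⇒<ᵇ≡true b<c | ≤⇒<ᵇ≡false (<⇒≤ b<c) | <⇒<ᵇ≡true (<-trans a<b b<c)
  | ≤⇒<ᵇ≡false (<⇒≤ (<-trans a<b b<c)) | <⇒≢ᵇ a<b = refl
... | tri< a<b _ _ | tri> _ _ c<b | tri< a<c _ _
  rewrite ≤⇒<ᵇ≡false (≤-refl {a}) | ≤⇒<ᵇ≡false (≤-refl {b}) | ≤⇒<ᵇ≡false (≤-refl {c}) | <⇒<ᵇ≡true a<b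
  | ≤⇒<ᵇ≡false (<⇒≤ a<b) | <⇒<ᵇ≡true c<b | ≤⇒<ᵇ≡false (<⇒≤ c<b) | <⇒<ᵇ≡true a<c | ≤⇒<ᵇ≡false (<⇒≤ a<c) | <⇒≢ᵇ a<c = refl
... | tri< a<b _ _ | tri> _ _ c<b | tri≈ _ refl _
  rewrite ≤⇒<ᵇ≡false (≤-refl {a}) | ≤⇒<ᵇ≡false (≤-refl {b}) | <⇒<ᵇ≡true a<b | ≤⇒<ᵇ≡false (<⇒≤ a<b) | ≡ᵇ-refl a = refl
... | tri< a<b _ _ | tri> _ _ c<b | tri> _ _ c<a
  rewrite ≤⇒<ᵇ≡false (≤-refl {a}) | ≤⇒<ᵇ≡false (≤-refl {b}) | ≤⇒<ᵇ≡false (≤-refl {c}) | <⇒<ᵇ≡true a<b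
  | ≤⇒<ᵇ≡false (<⇒≤ a<b) | <⇒<ᵇ≡true c<b | ≤⇒<ᵇ≡false (<⇒≤ c<b) | <⇒<ᵇ≡true c<a | ≤⇒<ᵇ≡false (<⇒≤ c<a) | >⇒≢ᵇ c<a = refl
... | tri< a<b _ _ | tri≈ _ refl _ | _
  rewrite ≤⇒<ᵇ≡false (≤-refl {a}) | ≤⇒<ᵇ≡false (≤-refl {b}) | <⇒<ᵇ≡true a<b | ≤⇒<ᵇ≡false (<⇒≤ a<b) = refl
... | tri> _ _ b<a | tri> _ _ c<b | _
  rewrite ≤⇒<ᵇ≡false (≤-refl {a}) | ≤⇒<ᵇ≡false (≤-refl {b}) | ≤⇒<ᵇ≡false (≤-refl {c}) | <⇒<ᵇ≡true b<a
  | ≤⇒<ᵇ≡false (<⇒≤ b<a) | <⇒<ᵇ≡true c<b | ≤⇒<ᵇ≡false (<⇒≤ c<b) | <⇒<ᵇ≡true (<-trans c<b b<a)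
  | ≤⇒<ᵇ≡false (<⇒≤ (<-trans c<b b<a)) | >⇒≢ᵇ c<b = refl
... | tri> _ _ b<a | tri< b<c _ _ | tri< a<c _ _
  rewrite ≤⇒<ᵇ≡false (≤-refl {a}) | ≤⇒<ᵇ≡false (≤-refl {b}) | ≤⇒<ᵇ≡false (≤-refl {c}) | <⇒<ᵇ≡true b<a
  | ≤⇒<ᵇ≡false (<⇒≤ b<a) | <⇒<ᵇ≡true b<c | ≤⇒<ᵇ≡false (<⇒≤ b<c) | <⇒<ᵇ≡true a<c | ≤⇒<ᵇ≡false (<⇒≤ a<c) | >⇒≢ᵇ b<a = refl
... | tri> _ _ b<a | tri< b<c _ _ | tri≈ _ refl _
  rewrite ≤⇒<ᵇ≡false (≤-refl {a}) | ≤⇒<ᵇ≡false (≤-refl {b}) | <⇒<ᵇ≡true b<a | ≤⇒<ᵇ≡false (<⇒≤ b<a) = refl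
... | tri> _ _ b<a | tri< b<c _ _ | tri> _ _ c<a
  rewrite ≤⇒<ᵇ≡false (≤-refl {a}) | ≤⇒<ᵇ≡false (≤-refl {b}) | ≤⇒<ᵇ≡false (≤-refl {c}) | <⇒<ᵇ≡true b<a
  | ≤⇒<ᵇ≡false (<⇒≤ b<a) | <⇒<ᵇ≡true b<c | ≤⇒<ᵇ≡false (<⇒≤ b<c) | <⇒<ᵇ≡true c<a | ≤⇒<ᵇ≡false (<⇒≤ c<a) | <⇒≢ᵇ b<c = refl
... | tri> _ _ b<a | tri≈ _ refl _ | _
  rewrite ≤⇒<ᵇ≡false (≤-refl {a}) | ≤⇒<ᵇ≡false (≤-refl {b}) | <⇒<ᵇ≡true b<a | ≤⇒<ᵇ≡false (<⇒≤ b<a) | ≡ᵇ-refl b = refl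
... | tri≈ _ refl _ | tri< b<c _ _ | _
  rewrite ≤⇒<ᵇ≡false (≤-refl {a}) | ≤⇒<ᵇ≡false (≤-refl {c}) | <⇒<ᵇ≡true b<c | ≤⇒<ᵇ≡false (<⇒≤ b<c) | ≡ᵇ-refl a = refl
... | tri≈ _ refl _ | tri> _ _ c<b | _
  rewrite ≤⇒<ᵇ≡false (≤-refl {a}) | ≤⇒<ᵇ≡false (≤-refl {c}) | <⇒<ᵇ≡true c<b | ≤⇒<ᵇ≡false (<⇒≤ c<b) = refl
... | tri≈ _ refl _ | tri≈ _ refl _ | _ rewrite ≤⇒<ᵇ≡false (≤-refl {a}) = refl

isLt isEq isGt : Sgn → Bool
isLt LT = true
isLt _  = false
isEq EQ = true
isEq _  = false
isGt GT = true
isGt _  = false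

sgn-<ᵇ : ∀ a b → (a <ᵇ b) ≡ isLt (sgn a b)
sgn-<ᵇ a b with <-cmp a b
... | tri< a<b _ _ rewrite <⇒<ᵇ≡true a<b = refl
... | tri≈ _ refl _ rewrite ≤⇒<ᵇ≡false (≤-refl {a}) = refl
... | tri> _ _ b<a rewrite ≤⇒<ᵇ≡false (<⇒≤ b<a) | <⇒<ᵇ≡true b<a = refl

sgn->ᵇ : ∀ a b → (b <ᵇ a) ≡ isGt (sgn a b)
sgn->ᵇ a b with <-cmp a b
... | tri< a<b _ _ rewrite <⇒<ᵇ≡true a<b | ≤⇒<ᵇ≡false (<⇒≤ a<b) = refl
... | tri≈ _ refl _ rewrite ≤⇒<ᵇ≡false (≤-refl {a}) = refl
... | tri> _ _ b<a rewrite ≤⇒<ᵇ≡false (<⇒≤ b<a) | <⇒<ᵇ≡true b<a = refl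

sgn-≡ᵇ : ∀ a b → (a ≡ᵇ b) ≡ isEq (sgn a b)
sgn-≡ᵇ a b with <-cmp a b
... | tri< a<b _ _ rewrite <⇒<ᵇ≡true a<b = <⇒≢ᵇ a<b
... | tri≈ _ refl _ rewrite ≤⇒<ᵇ≡false (≤-refl {a}) = ≡ᵇ-refl a
... | tri> _ _ b<a rewrite ≤⇒<ᵇ≡false (<⇒≤ b<a) | <⇒<ᵇ≡true b<a = >⇒≢ᵇ b<a

-- The 13 outcomes that transitivity permits, one for each weak ordering of three letters.
data Consistent : Sgn → Sgn → Sgn → Set where
  LT-LT : Consistent LT LT LT
  LT-EQ : Consistent LT EQ LT
  LT-GT : ∀ u → Consistent LT GT u
  EQ-EQ : ∀ t → Consistent EQ t t
  GT-LT : ∀ u → Consistent GT LT u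
  GT-EQ : Consistent GT EQ GT
  GT-GT : Consistent GT GT GT

sgn-consistent : ∀ a b c → Consistent (sgn a b) (sgn b c) (sgn a c)
sgn-consistent a b c with <-cmp a b | <-cmp b c
... | tri< a<b _ _  | tri< b<c _ _  rewrite <⇒<ᵇ≡true a<b | <⇒<ᵇ≡true b<c | <⇒<ᵇ≡true (<-trans a<b b<c) = LT-LT
... | tri< a<b _ _  | tri≈ _ refl _ rewrite <⇒<ᵇ≡true a<b | ≤⇒<ᵇ≡false (≤-refl {b}) = LT-EQ
... | tri< a<b _ _  | tri> _ _ c<b  rewrite <⇒<ᵇ≡true a<b | ≤⇒<ᵇ≡false (<⇒≤ c<b) | <⇒<ᵇ≡true c<b = LT-GT _
... | tri≈ _ refl _ | _             rewrite ≤⇒<ᵇ≡false (≤-refl {a}) = EQ-EQ _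
... | tri> _ _ b<a  | tri< b<c _ _  rewrite ≤⇒<ᵇ≡false (<⇒≤ b<a) | <⇒<ᵇ≡true b<a | <⇒<ᵇ≡true b<c = GT-LT _
... | tri> _ _ b<a  | tri≈ _ refl _ rewrite ≤⇒<ᵇ≡false (<⇒≤ b<a) | <⇒<ᵇ≡true b<a | ≤⇒<ᵇ≡false (≤-refl {b}) = GT-EQ
... | tri> _ _ b<a  | tri> _ _ c<b  rewrite ≤⇒<ᵇ≡false (<⇒≤ b<a) | <⇒<ᵇ≡true b<a | ≤⇒<ᵇ≡false (<⇒≤ c<b) | <⇒<ᵇ≡true c<b
  | ≤⇒<ᵇ≡false (<⇒≤ (<-trans c<b b<a)) | <⇒<ᵇ≡true (<-trans c<b b<a) = GT-GT

allOrders : (Sgn → Sgn → Sgn → Bool) → Bool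
allOrders f =
  f LT LT LT ∧ f LT EQ LT ∧ (f LT GT LT ∧ f LT GT EQ ∧ f LT GT GT) ∧
  (f EQ LT LT ∧ f EQ EQ EQ ∧ f EQ GT GT) ∧
  (f GT LT LT ∧ f GT LT EQ ∧ f GT LT GT) ∧ f GT EQ GT ∧ f GT GT GT

∧-splitˡ : ∀ {a b} → a ∧ b ≡ true → a ≡ true
∧-splitˡ {true} _ = refl

∧-splitʳ : ∀ {a b} → a ∧ b ≡ true → b ≡ true
∧-splitʳ {true} h = h

choose : ∀ (f : Sgn → Bool) → f LT ∧ f EQ ∧ f GT ≡ true → ∀ s → f s ≡ true
choose f h LT = ∧-splitˡ h
choose f h EQ = ∧-splitˡ (∧-splitʳ {f LT} h)
choose f h GT = ∧-splitʳ {f EQ} (∧-splitʳ {f LT} h)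

allOrders-sound : ∀ f → allOrders f ≡ true → ∀ {s t u} → Consistent s t u → f s t u ≡ true
allOrders-sound f h₀ =
  let h₁ = ∧-splitʳ {f LT LT LT} h₀
      h₂ = ∧-splitʳ {f LT EQ LT} h₁
      h₃ = ∧-splitʳ {f LT GT LT ∧ f LT GT EQ ∧ f LT GT GT} h₂
      h₄ = ∧-splitʳ {f EQ LT LT ∧ f EQ EQ EQ ∧ f EQ GT GT} h₃
      h₅ = ∧-splitʳ {f GT LT LT ∧ f GT LT EQ ∧ f GT LT GT} h₄
  in λ where
    LT-LT     → ∧-splitˡ h₀
    LT-EQ     → ∧-splitˡ h₁
    (LT-GT u) → choose (f LT GT) (∧-splitˡ h₂) u
    (EQ-EQ t) → choose (λ t → f EQ t t) (∧-splitˡ h₃) t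
    (GT-LT u) → choose (f GT LT) (∧-splitˡ h₄) u
    GT-EQ     → ∧-splitˡ h₅
    GT-GT     → ∧-splitʳ {f GT EQ GT} h₅

⇔ᵇ⇒≡ : ∀ a b → (a ⇔ᵇ b) ≡ true → a ≡ b
⇔ᵇ⇒≡ true  true  _ = refl
⇔ᵇ⇒≡ false false _ = refl

matchᵒ : HVPattern → Sgn → Sgn → Sgn → Bool
matchᵒ p s t u = does (≡-dec _≟_ (ordered s t u) (word p))

match≡matchᵒ : ∀ p a b c → match p a b c ≡ matchᵒ p (sgn a b) (sgn b c) (sgn a c)
match≡matchᵒ p a b c = cong (λ w → does (≡-dec _≟_ w (word p)))
  (trans (reduction≡reductionⁱ (a ∷ b ∷ c ∷ [])) (reductionⁱ≡red a b c))

-- Turns the description of a pattern by inequalities into 13 Boolean checks, which `refl` settles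
-- for each concrete pattern.
match-by-order : ∀ p (f : Sgn → Sgn → Sgn → Bool) → allOrders (λ s t u → matchᵒ p s t u ⇔ᵇ f s t u) ≡ true →
  ∀ a b c → match p a b c ≡ f (sgn a b) (sgn b c) (sgn a c)
match-by-order p f h a b c = trans (match≡matchᵒ p a b c)
  (⇔ᵇ⇒≡ _ _ (allOrders-sound (λ s t u → matchᵒ p s t u ⇔ᵇ f s t u) h (sgn-consistent a b c)))

≡ᵇ-sym : ∀ a b → (a ≡ᵇ b) ≡ (b ≡ᵇ a)
≡ᵇ-sym zero    zero    = refl
≡ᵇ-sym zero    (suc b) = refl
≡ᵇ-sym (suc a) zero    = refl
≡ᵇ-sym (suc a) (suc b) = ≡ᵇ-sym a b

match-u01-0 : ∀ a b c → match u01-0 a b c ≡ (a <ᵇ b) ∧ (c ≡ᵇ a)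
match-u01-0 a b c = trans (match-by-order u01-0 (λ s t u → isLt s ∧ isEq u) refl a b c)
  (sym (cong₂ _∧_ (sgn-<ᵇ a b) (trans (≡ᵇ-sym c a) (sgn-≡ᵇ a c))))

match-u01-1 : ∀ a b c → match u01-1 a b c ≡ (a <ᵇ b) ∧ (c ≡ᵇ b)
match-u01-1 a b c = trans (match-by-order u01-1 (λ s t u → isLt s ∧ isEq t) refl a b c)
  (sym (cong₂ _∧_ (sgn-<ᵇ a b) (trans (≡ᵇ-sym c b) (sgn-≡ᵇ b c))))

match-u10-0 : ∀ a b c → match u10-0 a b c ≡ (b <ᵇ a) ∧ (c ≡ᵇ b)
match-u10-0 a b c = trans (match-by-order u10-0 (λ s t u → isGt s ∧ isEq t) refl a b c)
  (sym (cong₂ _∧_ (sgn->ᵇ a b) (trans (≡ᵇ-sym c b) (sgn-≡ᵇ b c))))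

match-u10-1 : ∀ a b c → match u10-1 a b c ≡ (b <ᵇ a) ∧ (c ≡ᵇ a)
match-u10-1 a b c = trans (match-by-order u10-1 (λ s t u → isGt s ∧ isEq u) refl a b c)
  (sym (cong₂ _∧_ (sgn->ᵇ a b) (trans (≡ᵇ-sym c a) (sgn-≡ᵇ a c))))

match-1-u01 : ∀ a b c → match 1-u01 a b c ≡ (b <ᵇ c) ∧ (a ≡ᵇ c)
match-1-u01 a b c = trans (match-by-order 1-u01 (λ s t u → isLt t ∧ isEq u) refl a b c)
  (sym (cong₂ _∧_ (sgn-<ᵇ b c) (sgn-≡ᵇ a c)))

match-1-u10 : ∀ a b c → match 1-u10 a b c ≡ (c <ᵇ b) ∧ (a ≡ᵇ b)
match-1-u10 a b c = trans (match-by-order 1-u10 (λ s t u → isGt t ∧ isEq s) refl a b c)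
  (sym (cong₂ _∧_ (sgn->ᵇ b c) (sgn-≡ᵇ a b)))

match-2-u01 : ∀ a b c → match 2-u01 a b c ≡ (b <ᵇ c) ∧ (c <ᵇ a)
match-2-u01 a b c = trans (match-by-order 2-u01 (λ s t u → isLt t ∧ isGt u) refl a b c)
  (sym (cong₂ _∧_ (sgn-<ᵇ b c) (sgn->ᵇ a c)))

match-2-u10 : ∀ a b c → match 2-u10 a b c ≡ (c <ᵇ b) ∧ (b <ᵇ a)
match-2-u10 a b c = trans (match-by-order 2-u10 (λ s t u → isGt t ∧ isGt s) refl a b c)
  (sym (cong₂ _∧_ (sgn->ᵇ b c) (sgn->ᵇ a b)))

-- Avoiders grown one letter at a time.

allowed : HVPattern → List ℕ → ℕ → Bool
allowed p r x = new p r x ≡ᵇ 0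

avoiders : HVPattern → ℕ → List ℕ → ℕ
avoiders p zero    r = 1
avoiders p (suc k) r = ∑[ x < suc (length r) ] (if allowed p r x then avoiders p k (x ∷ r) else 0)

-- Appending letters never removes an occurrence, so a word that has one contributes nothing, and
-- only allowed letters need to be followed.
total-avoiders : ∀ p k r → total k (λ r → bit (occ p r ≡ᵇ 0)) r ≡ (if occ p r ≡ᵇ 0 then avoiders p k r else 0)
total-avoiders p zero r with occ p r ≡ᵇ 0
... | true  = refl
... | false = refl
total-avoiders p (suc k) r with occ p r in eq
... | zero  = ∑-cong (suc (length r)) (λ x _ → trans (total-avoiders p k (x ∷ r))
  (cong (λ o → if (o + new p r x) ≡ᵇ 0 then avoiders p k (x ∷ r) else 0) eq))
... | suc o = ∑-zero (suc (length r)) (λ x _ → trans (total-avoiders p k (x ∷ r))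
  (cong (λ o → if (o + new p r x) ≡ᵇ 0 then avoiders p k (x ∷ r) else 0) eq))

count-avoiders : ∀ p n → count p n 0 ≡ avoiders p n []
count-avoiders p n = trans (count-total p n 0) (total-avoiders p n [])

≢⇒≢ᵇ : ∀ {m n} → m ≢ n → (m ≡ᵇ n) ≡ false
≢⇒≢ᵇ {m} {n} m≢n with <-cmp m n
... | tri< m<n _ _ = <⇒≢ᵇ m<n
... | tri≈ _ m≡n _ = contradiction m≡n m≢n
... | tri> _ _ n<m = >⇒≢ᵇ n<m

-- Ranks of the allowed letters.

cnt : (ℕ → Bool) → ℕ → ℕ
cnt A n = ∑[ x < n ] bit (A x)

-- As `x` runs through the values below `n` that satisfy `A`, its rank `cnt A x` takes each value
-- below `cnt A n` exactly once. Hence a tree that depends on ranks only forgets which letters are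
-- allowed.
∑-rank : ∀ A n g → ∑[ x < n ] (if A x then g (cnt A x) else 0) ≡ ∑< (cnt A n) g
∑-rank A zero    g = refl
∑-rank A (suc n) g with A n
... | true  = trans (cong (_+ g (cnt A n)) (∑-rank A n g)) (cong (λ m → ∑< m g) (+-comm 1 (cnt A n)))
... | false = trans (cong (_+ 0) (∑-rank A n g)) (trans (+-identityʳ _) (cong (λ m → ∑< m g) (sym (+-identityʳ (cnt A n)))))

cnt-mono : ∀ A {m n} → m ≤ n → cnt A m ≤ cnt A n
cnt-mono A {m} {n} m≤n = subst (λ z → cnt A m ≤ cnt A z) (m+[n∸m]≡n m≤n)
  (subst (cnt A m ≤_) (sym (∑-split m (n ∸ m) (bit ∘ A))) (m≤m+n _ _))

cnt-suc : ∀ A {x} → A x ≡ true → cnt A (suc x) ≡ suc (cnt A x)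
cnt-suc A {x} h rewrite h = +-comm (cnt A x) 1

_without_ : (ℕ → Bool) → ℕ → ℕ → Bool
(A without y) z = A z ∧ not (z ≡ᵇ y)

cnt-without-≤ : ∀ A {y} n → n ≤ y → cnt (A without y) n ≡ cnt A n
cnt-without-≤ A n n≤y = ∑-cong n (λ z z<n → cong bit
  (trans (cong (λ b → A z ∧ not b) (<⇒≢ᵇ (<-≤-trans z<n n≤y))) (∧-identityʳ (A z))))

cnt-without-> : ∀ A {y n} → A y ≡ true → y < n → cnt A n ≡ suc (cnt (A without y) n)
cnt-without-> A {y} {suc n} Ay (s≤s y≤n) with m≤n⇒m<n∨m≡n y≤n
... | inj₁ y<n  = cong₂ _+_ (cnt-without-> A Ay y<n)
  (cong bit (sym (trans (cong (λ b → A n ∧ not b) (>⇒≢ᵇ y<n)) (∧-identityʳ (A n)))))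
... | inj₂ refl rewrite Ay | ≡ᵇ-refl y | cnt-without-≤ A y ≤-refl = trans (+-comm (cnt A y) 1) (cong suc (sym (+-identityʳ _)))

-- The pairs 01-0, 01-1 and 10-0, 10-1.

Avoids : HVPattern → List ℕ → Set
Avoids p []      = ⊤
Avoids p (x ∷ r) = x ≤ length r × allowed p r x ≡ true × Avoids p r

-- Which letter of an underlined pair is forbidden afterwards: the earlier one for 01-0 and 10-1,
-- the later one for 01-1 and 10-0.
data Dropped : Set where
  previous current : Dropped

dropped : Dropped → ℕ → ℕ → ℕ
dropped previous l y = l
dropped current  l y = y

dropped-≤ : ∀ d {l y n} → l ≤ n → y ≤ n → dropped d l y ≤ n
dropped-≤ previous l≤n y≤n = l≤n
dropped-≤ current  l≤n y≤n = y≤n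

dropped-≥ : ∀ d {l y n} → n ≤ l → n ≤ y → n ≤ dropped d l y
dropped-≥ previous n≤l n≤y = n≤l
dropped-≥ current  n≤l n≤y = n≤y

if-cong : ∀ {b} {m n k : ℕ} → (b ≡ true → m ≡ n) → (if b then m else k) ≡ (if b then n else k)
if-cong {true}  h = h refl
if-cong {false} _ = refl

cnt-cong : ∀ {A B} n → (∀ z → A z ≡ B z) → cnt A n ≡ cnt B n
cnt-cong n h = ∑-cong n (λ z _ → cong bit (h z))

-- A pair l y of the underlined type (moves l y) makes one further value forbidden,
-- namely one of its two letters.
module Forbidding (w₁ w₂ w₃ : ℕ) (moves : ℕ → ℕ → Bool) (moves-irrefl : ∀ l → moves l l ≡ false) (d : Dropped)
  (match≡ : ∀ l y z → match (hvp w₁ w₂ w₃ left) l y z ≡ moves l y ∧ (z ≡ᵇ dropped d l y))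
  where

  p : HVPattern
  p = hvp w₁ w₂ w₃ left

  stays : ∀ y l r z → moves l y ≡ false → allowed p (y ∷ l ∷ r) z ≡ allowed p (l ∷ r) z
  stays y l r z h rewrite match≡ l y z | h = refl

  drops : ∀ y l r z → moves l y ≡ true → allowed p (y ∷ l ∷ r) z ≡ (allowed p (l ∷ r) without dropped d l y) z
  drops y l r z h rewrite match≡ l y z | h with z ≡ᵇ dropped d l y
  ... | true  = sym (∧-zeroʳ _)
  ... | false = sym (∧-identityʳ _)

  allowed-∷ : ∀ y l r z → z ≢ dropped d l y → allowed p (y ∷ l ∷ r) z ≡ allowed p (l ∷ r) z
  allowed-∷ y l r z z≢ with moves l y in eq
  ... | false = stays y l r z eq
  ... | true  = trans (drops y l r z eq) (trans (cong (λ b → allowed p (l ∷ r) z ∧ not b) (≢⇒≢ᵇ z≢)) (∧-identityʳ _))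

  -- Only letters of the word become forbidden, and these are smaller than its length. So the value
  -- that becomes available with each new position is always allowed.
  allowed-large : ∀ l r z → Avoids p (l ∷ r) → suc (length r) ≤ z → allowed p (l ∷ r) z ≡ true
  allowed-large y []      z _ _ = refl
  allowed-large y (l ∷ r) z (y≤ , _ , av) n<z = trans
    (allowed-∷ y l r z (>⇒≢ (≤-<-trans (dropped-≤ d (m≤n⇒m≤1+n (proj₁ av)) y≤) n<z)))
    (allowed-large l r z av (<⇒≤ n<z))

  -- The last letter was allowed when it was chosen, and its arrival forbids at most the letter
  -- before it, which is then a different one.
  allowed-previous : ∀ l r → d ≡ previous → Avoids p (l ∷ r) → allowed p (l ∷ r) l ≡ true
  allowed-previous y []      _    _                = refl
  allowed-previous y (l ∷ r) d≡ (_ , allowed-y , _) with y ≟ l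
  ... | yes refl = trans (stays y y r y (moves-irrefl y)) allowed-y
  ... | no  y≢l  = trans (allowed-∷ y l r y (λ eq → y≢l (trans eq (cong (λ e → dropped e l y) d≡)))) allowed-y

  -- Ensures that a newly forbidden letter was still allowed, so that the number of allowed letters
  -- drops by exactly one.
  allowed-dropped : ∀ l r y → Avoids p (l ∷ r) → allowed p (l ∷ r) y ≡ true → allowed p (l ∷ r) (dropped d l y) ≡ true
  allowed-dropped l r y av h = by-cases d refl
    where
    by-cases : ∀ e → d ≡ e → allowed p (l ∷ r) (dropped e l y) ≡ true
    by-cases previous eq = allowed-previous l r eq av
    by-cases current  eq = h

-- Here `a` letters may follow. Of these, `b` are at most the last letter in `ascentTree`, and
-- strictly below it in `descentTree`. Thus `t <ᵇ b` says that the letter of rank `t` makes no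
-- ascent, respectively that it makes a descent.
ascentTree descentTree : ℕ → ℕ → ℕ → ℕ
ascentTree zero    a b = 1
ascentTree (suc k) a b = ∑[ t < a ] (if t <ᵇ b then ascentTree k (suc a) (suc t) else ascentTree k a t)
descentTree zero    a b = 1
descentTree (suc k) a b = ∑[ t < a ] (if t <ᵇ b then descentTree k a t else descentTree k (suc a) t)

module Ascents (w₁ w₂ w₃ : ℕ) (d : Dropped)
  (match≡ : ∀ l y z → match (hvp w₁ w₂ w₃ left) l y z ≡ (l <ᵇ y) ∧ (z ≡ᵇ dropped d l y))
  where

  open Forbidding w₁ w₂ w₃ (λ l y → l <ᵇ y) (λ l → ≤⇒<ᵇ≡false (≤-refl {l})) d match≡

  avoiders-tree : ∀ k l r → Avoids p (l ∷ r) → let A = allowed p (l ∷ r) in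
    avoiders p k (l ∷ r) ≡ ascentTree k (cnt A (2 + length r)) (cnt A (suc l))
  avoiders-tree zero    l r av = refl
  avoiders-tree (suc k) l r av@(l≤ , _) = begin
    (∑[ x < suc n ] (if A x then avoiders p k (x ∷ l ∷ r) else 0))
      ≡⟨ ∑-cong (suc n) (λ x x≤n → if-cong (extend x (≤-pred x≤n))) ⟩
    (∑[ x < suc n ] (if A x then g (cnt A x) else 0))
      ≡⟨ ∑-rank A (suc n) g ⟩
    ∑< a g ∎
    where
    n = suc (length r)
    A = allowed p (l ∷ r)
    a = cnt A (suc n)
    b = cnt A (suc l)
    g : ℕ → ℕ
    g t = if t <ᵇ b then ascentTree k (suc a) (suc t) else ascentTree k a t
    extend : ∀ x → x ≤ n → A x ≡ true → avoiders p k (x ∷ l ∷ r) ≡ g (cnt A x)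
    extend x x≤n Ax with <-≤-connex l x
    -- No ascent: the forbidden letters stay the same and the count grows by the new value `suc n`.
    ... | inj₂ x≤l rewrite <⇒<ᵇ≡true (<-≤-trans (subst (cnt A x <_) (sym (cnt-suc A Ax)) ≤-refl) (cnt-mono A (s≤s x≤l))) = begin
      avoiders p k (x ∷ l ∷ r)                          ≡⟨ avoiders-tree k x (l ∷ r) (x≤n , Ax , av) ⟩
      ascentTree k (cnt A′ (2 + n)) (cnt A′ (suc x))    ≡⟨ cong₂ (ascentTree k) (cnt-cong (2 + n) same) (cnt-cong (suc x) same) ⟩
      ascentTree k (cnt A (2 + n)) (cnt A (suc x))      ≡⟨ cong₂ (ascentTree k) (cnt-suc A (allowed-large l r (suc n) av (n≤1+n n))) (cnt-suc A Ax) ⟩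
      ascentTree k (suc a) (suc (cnt A x))              ∎
      where
      A′ = allowed p (x ∷ l ∷ r)
      same : ∀ z → A′ z ≡ A z
      same z = stays x l r z (≤⇒<ᵇ≡false x≤l)
    -- Ascent: the forbidden letter is at most `x`, so its loss offsets the new value `suc n` in the
    -- first count and `x` itself in the second.
    ... | inj₁ l<x rewrite ≤⇒<ᵇ≡false (cnt-mono A l<x) = begin
      avoiders p k (x ∷ l ∷ r)                              ≡⟨ avoiders-tree k x (l ∷ r) (x≤n , Ax , av) ⟩
      ascentTree k (cnt A′ (2 + n)) (cnt A′ (suc x))        ≡⟨ cong₂ (ascentTree k) (cnt-cong (2 + n) same) (cnt-cong (suc x) same) ⟩
      ascentTree k (cnt A″ (2 + n)) (cnt A″ (suc x))        ≡⟨ cong₂ (ascentTree k) (suc-injective (trans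
          (sym (cnt-without-> A Ay (s≤s (≤-trans y≤x (m≤n⇒m≤1+n x≤n)))))
          (cnt-suc A (allowed-large l r (suc n) av (n≤1+n n)))))
        (suc-injective (trans (sym (cnt-without-> A Ay (s≤s y≤x))) (cnt-suc A Ax))) ⟩
      ascentTree k a (cnt A x)                              ∎
      where
      A′ = allowed p (x ∷ l ∷ r)
      A″ = A without dropped d l x
      y≤x : dropped d l x ≤ x
      y≤x = dropped-≤ d (<⇒≤ l<x) ≤-refl
      Ay : A (dropped d l x) ≡ true
      Ay = allowed-dropped l r x av Ax
      same : ∀ z → A′ z ≡ A″ z
      same z = drops x l r z (<⇒<ᵇ≡true l<x)

module Descents (w₁ w₂ w₃ : ℕ) (d : Dropped)
  (match≡ : ∀ l y z → match (hvp w₁ w₂ w₃ left) l y z ≡ (y <ᵇ l) ∧ (z ≡ᵇ dropped d l y))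
  where

  open Forbidding w₁ w₂ w₃ (λ l y → y <ᵇ l) (λ l → ≤⇒<ᵇ≡false (≤-refl {l})) d match≡

  avoiders-tree : ∀ k l r → Avoids p (l ∷ r) → let A = allowed p (l ∷ r) in
    avoiders p k (l ∷ r) ≡ descentTree k (cnt A (2 + length r)) (cnt A l)
  avoiders-tree zero    l r av = refl
  avoiders-tree (suc k) l r av@(l≤ , _) = begin
    (∑[ x < suc n ] (if A x then avoiders p k (x ∷ l ∷ r) else 0))
      ≡⟨ ∑-cong (suc n) (λ x x≤n → if-cong (extend x (≤-pred x≤n))) ⟩
    (∑[ x < suc n ] (if A x then g (cnt A x) else 0))
      ≡⟨ ∑-rank A (suc n) g ⟩
    ∑< a g ∎
    where
    n = suc (length r)
    A = allowed p (l ∷ r)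
    a = cnt A (suc n)
    b = cnt A l
    g : ℕ → ℕ
    g t = if t <ᵇ b then descentTree k a t else descentTree k (suc a) t
    extend : ∀ x → x ≤ n → A x ≡ true → avoiders p k (x ∷ l ∷ r) ≡ g (cnt A x)
    extend x x≤n Ax with <-≤-connex x l
    ... | inj₂ l≤x rewrite ≤⇒<ᵇ≡false (cnt-mono A l≤x) = begin
      avoiders p k (x ∷ l ∷ r)                     ≡⟨ avoiders-tree k x (l ∷ r) (x≤n , Ax , av) ⟩
      descentTree k (cnt A′ (2 + n)) (cnt A′ x)    ≡⟨ cong₂ (descentTree k) (cnt-cong (2 + n) same) (cnt-cong x same) ⟩
      descentTree k (cnt A (2 + n)) (cnt A x)      ≡⟨ cong (λ m → descentTree k m (cnt A x)) (cnt-suc A (allowed-large l r (suc n) av (n≤1+n n))) ⟩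
      descentTree k (suc a) (cnt A x)              ∎
      where
      A′ = allowed p (x ∷ l ∷ r)
      same : ∀ z → A′ z ≡ A z
      same z = stays x l r z (≤⇒<ᵇ≡false l≤x)
    -- Descent: the forbidden letter is at least `x`, so its loss offsets the new value `suc n` but
    -- leaves the count below `x` unchanged.
    ... | inj₁ x<l rewrite <⇒<ᵇ≡true (<-≤-trans (subst (cnt A x <_) (sym (cnt-suc A Ax)) ≤-refl) (cnt-mono A x<l)) = begin
      avoiders p k (x ∷ l ∷ r)                              ≡⟨ avoiders-tree k x (l ∷ r) (x≤n , Ax , av) ⟩
      descentTree k (cnt A′ (2 + n)) (cnt A′ x)             ≡⟨ cong₂ (descentTree k) (cnt-cong (2 + n) same) (cnt-cong x same) ⟩
      descentTree k (cnt A″ (2 + n)) (cnt A″ x)             ≡⟨ cong₂ (descentTree k) (suc-injective (trans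
          (sym (cnt-without-> A Ay (s≤s (≤-trans (dropped-≤ d ≤-refl (<⇒≤ x<l)) (≤-trans l≤ (m≤n⇒m≤1+n (n≤1+n _)))))))
          (cnt-suc A (allowed-large l r (suc n) av (n≤1+n n)))))
        (cnt-without-≤ A x (dropped-≥ d (<⇒≤ x<l) ≤-refl)) ⟩
      descentTree k a (cnt A x)                             ∎
      where
      A′ = allowed p (x ∷ l ∷ r)
      A″ = A without dropped d l x
      Ay : A (dropped d l x) ≡ true
      Ay = allowed-dropped l r x av Ax
      same : ∀ z → A′ z ≡ A″ z
      same z = drops x l r z (<⇒<ᵇ≡true x<l)

u01-0~u01-1 : WilfEq u01-0 u01-1
u01-0~u01-1 zero    = refl
u01-0~u01-1 (suc n) = begin
  count u01-0 (suc n) 0       ≡⟨ count-avoiders u01-0 (suc n) ⟩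
  avoiders u01-0 n (0 ∷ [])   ≡⟨ Ascents.avoiders-tree 0 1 0 previous match-u01-0 n 0 [] (z≤n , refl , tt) ⟩
  -- After the forced first letter 0, both 0 and 1 may follow; one of them is at most 0.
  ascentTree n 2 1            ≡⟨ Ascents.avoiders-tree 0 1 1 current match-u01-1 n 0 [] (z≤n , refl , tt) ⟨
  avoiders u01-1 n (0 ∷ [])   ≡⟨ count-avoiders u01-1 (suc n) ⟨
  count u01-1 (suc n) 0       ∎

u10-0~u10-1 : WilfEq u10-0 u10-1
u10-0~u10-1 zero    = refl
u10-0~u10-1 (suc n) = begin
  count u10-0 (suc n) 0       ≡⟨ count-avoiders u10-0 (suc n) ⟩
  avoiders u10-0 n (0 ∷ [])   ≡⟨ Descents.avoiders-tree 1 0 0 current match-u10-0 n 0 [] (z≤n , refl , tt) ⟩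
  -- The same two letters may follow, and none is below 0.
  descentTree n 2 0           ≡⟨ Descents.avoiders-tree 1 0 1 previous match-u10-1 n 0 [] (z≤n , refl , tt) ⟨
  avoiders u10-1 n (0 ∷ [])   ≡⟨ count-avoiders u10-1 (suc n) ⟨
  count u10-1 (suc n) 0       ∎

-- The pair 2-01, 2-10.

maximum : List ℕ → ℕ
maximum []      = 0
maximum (x ∷ r) = x ⊔ maximum r

<ᵇ-⊔ : ∀ x a b → (x <ᵇ a ⊔ b) ≡ (x <ᵇ a) ∨ (x <ᵇ b)
<ᵇ-⊔ x       zero    b       = refl
<ᵇ-⊔ x       (suc a) zero    = sym (∨-identityʳ (x <ᵇ suc a))
<ᵇ-⊔ zero    (suc a) (suc b) = refl
<ᵇ-⊔ (suc x) (suc a) (suc b) = <ᵇ-⊔ x a b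

none-above : ∀ x r → (∑∈ r (λ z → bit (x <ᵇ z)) ≡ᵇ 0) ≡ not (x <ᵇ maximum r)
none-above x []      = refl
none-above x (z ∷ r) rewrite <ᵇ-⊔ x z (maximum r) with x <ᵇ z
... | true  = refl
... | false = none-above x r

∑∈-zero : ∀ {A : Set} (xs : List A) → ∑∈ xs (λ _ → 0) ≡ 0
∑∈-zero []       = refl
∑∈-zero (x ∷ xs) = ∑∈-zero xs

-- The first letter of an occurrence comes from `r`. Using the maximum of `l ∷ r` instead is
-- harmless, because `l < x` excludes `x < l`.
allowed-2-u01 : ∀ l r x → allowed 2-u01 (l ∷ r) x ≡ not ((l <ᵇ x) ∧ (x <ᵇ maximum (l ∷ r)))
allowed-2-u01 l r x = trans (cong (_≡ᵇ 0) (∑∈-cong r (λ z → cong bit (match-2-u01 z l x)))) (lemma (<-≤-connex l x))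
  where
  lemma : l < x ⊎ x ≤ l → (∑∈ r (λ z → bit ((l <ᵇ x) ∧ (x <ᵇ z))) ≡ᵇ 0) ≡ not ((l <ᵇ x) ∧ (x <ᵇ maximum (l ∷ r)))
  lemma (inj₁ l<x) rewrite <⇒<ᵇ≡true l<x | <ᵇ-⊔ x l (maximum r) | ≤⇒<ᵇ≡false (<⇒≤ l<x) = none-above x r
  lemma (inj₂ x≤l) rewrite ≤⇒<ᵇ≡false x≤l | ∑∈-zero r = refl

allowed-2-u10 : ∀ l r x → allowed 2-u10 (l ∷ r) x ≡ not ((x <ᵇ l) ∧ (l <ᵇ maximum (l ∷ r)))
allowed-2-u10 l r x = trans (cong (_≡ᵇ 0) (∑∈-cong r (λ z → cong bit (match-2-u10 z l x)))) lemma
  where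
  lemma : (∑∈ r (λ z → bit ((x <ᵇ l) ∧ (l <ᵇ z))) ≡ᵇ 0) ≡ not ((x <ᵇ l) ∧ (l <ᵇ maximum (l ∷ r)))
  lemma rewrite <ᵇ-⊔ l l (maximum r) | ≤⇒<ᵇ≡false (≤-refl {l}) with x <ᵇ l
  ... | true  = none-above l r
  ... | false = cong (_≡ᵇ 0) (∑∈-zero r)

-- The state is the length `n`, the maximum `M` and the number `b` of letters below `M` that may
-- follow. The first sum keeps the maximum. In the second, `y` becomes or remains the maximum as
-- last letter, after which all `y` smaller letters may follow.
maxTree : ℕ → ℕ → ℕ → ℕ → ℕ
maxTree zero    n M b = 1
maxTree (suc k) n M b =
  ∑[ t < b ] maxTree k (suc n) M (suc t) + ∑[ y < suc n ] (if y <ᵇ M then 0 else maxTree k (suc n) y y)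

∑-< : ∀ {b n} f → b ≤ n → ∑[ x < n ] (if x <ᵇ b then f x else 0) ≡ ∑< b f
∑-< {b} {n} f b≤n = begin
  ∑< n h                                  ≡⟨ cong (λ m → ∑< m h) (m+[n∸m]≡n b≤n) ⟨
  ∑< (b + (n ∸ b)) h                      ≡⟨ ∑-split b (n ∸ b) h ⟩
  ∑< b h + ∑[ i < n ∸ b ] h (b + i)
    ≡⟨ cong₂ _+_ (∑-cong b (λ x x<b → cong (λ c → if c then f x else 0) (<⇒<ᵇ≡true x<b)))
                 (∑-zero (n ∸ b) (λ i _ → cong (λ c → if c then f (b + i) else 0) (≤⇒<ᵇ≡false (m≤m+n b i)))) ⟩
  ∑< b f + 0                              ≡⟨ +-identityʳ _ ⟩
  ∑< b f                                  ∎
  where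
  h : ℕ → ℕ
  h x = if x <ᵇ b then f x else 0

∑-head : ∀ n f → ∑< (suc n) f ≡ f 0 + ∑[ x < n ] f (suc x)
∑-head n f = ∑-split 1 n f

-- The substitution `suc t = M ∸ x` reverses the interval from `c` to `M`.
∑-reflect : ∀ M c (f : ℕ → ℕ) → ∑[ x < M ] (if x <ᵇ c then 0 else f (M ∸ x)) ≡ ∑[ t < M ∸ c ] f (suc t)
∑-reflect zero    zero    f = refl
∑-reflect zero    (suc c) f = refl
∑-reflect (suc M) zero    f = trans (∑-head M (λ x → f (suc M ∸ x)))
  (trans (cong (f (suc M) +_) (∑-reflect M 0 f)) (+-comm (f (suc M)) _))
∑-reflect (suc M) (suc c) f = trans (∑-head M (λ x → if x <ᵇ suc c then 0 else f (suc M ∸ x))) (∑-reflect M c f)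

∑-split-if : ∀ n (A : ℕ → Bool) (f : ℕ → ℕ) → ∑< n f ≡ ∑[ x < n ] (if A x then f x else 0) + ∑[ x < n ] (if A x then 0 else f x)
∑-split-if n A f = trans (∑-cong n (λ x _ → pointwise (A x) (f x))) (∑-+ n _ _)
  where
  pointwise : ∀ c m → m ≡ (if c then m else 0) + (if c then 0 else m)
  pointwise true  m = sym (+-identityʳ m)
  pointwise false m = refl

Bounded : List ℕ → Set
Bounded r = maximum r < length r

∷-bounded : ∀ {x} r → x ≤ length r → Bounded r → Bounded (x ∷ r)
∷-bounded r x≤ b = s≤s (⊔-lub x≤ (<⇒≤ b))

⊔-below : ∀ {x M} → x < M → x ⊔ M ≡ M
⊔-below x<M = m≤n⇒m⊔n≡n (<⇒≤ x<M)

-- b l M counts the letters below the maximum M that may follow the last letter l.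
Below : HVPattern → (ℕ → ℕ → ℕ) → Set
Below p b = ∀ l r (f : ℕ → ℕ) → let M = maximum (l ∷ r) in
  ∑[ x < M ] (if allowed p (l ∷ r) x then f (b x M) else 0) ≡ ∑[ t < b l M ] f (suc t)

module MaxTree (p : HVPattern) (b : ℕ → ℕ → ℕ) (b-max : ∀ M → b M M ≡ M)
  (allowed-max : ∀ l r x → maximum (l ∷ r) ≤ x → allowed p (l ∷ r) x ≡ true)
  (below : Below p b)
  where

  avoiders-tree : ∀ k l r → Bounded (l ∷ r) → avoiders p k (l ∷ r) ≡ maxTree k (suc (length r)) (maximum (l ∷ r)) (b l (maximum (l ∷ r)))
  avoiders-tree zero    l r bd = refl
  avoiders-tree (suc k) l r bd = begin
    ∑< (suc n) f
      ≡⟨ ∑-split-if (suc n) (_<ᵇ M) f ⟩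
    ∑[ x < suc n ] (if x <ᵇ M then f x else 0) + ∑[ x < suc n ] (if x <ᵇ M then 0 else f x)
      ≡⟨ cong₂ _+_ (∑-< f (m≤n⇒m≤1+n (<⇒≤ bd))) (∑-cong (suc n) (λ x x≤n → large x (≤-pred x≤n) (<-≤-connex x M))) ⟩
    ∑< M f + ∑[ x < suc n ] (if x <ᵇ M then 0 else maxTree k (suc n) x x)
      ≡⟨ cong (_+ ∑[ x < suc n ] (if x <ᵇ M then 0 else maxTree k (suc n) x x))
           (trans (∑-cong M (λ x x<M → if-cong {allowed p (l ∷ r) x} (λ _ → small x x<M))) (below l r (maxTree k (suc n) M))) ⟩
    maxTree (suc k) n M (b l M) ∎
    where
    n = suc (length r)
    M = maximum (l ∷ r)
    f : ℕ → ℕ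
    f x = if allowed p (l ∷ r) x then avoiders p k (x ∷ l ∷ r) else 0
    small : ∀ x → x < M → avoiders p k (x ∷ l ∷ r) ≡ maxTree k (suc n) M (b x M)
    small x x<M = trans (avoiders-tree k x (l ∷ r) (∷-bounded (l ∷ r) (<⇒≤ (<-trans x<M bd)) bd))
      (cong (λ m → maxTree k (suc n) m (b x m)) (⊔-below x<M))
    large : ∀ x → x ≤ n → x < M ⊎ M ≤ x → (if x <ᵇ M then 0 else f x) ≡ (if x <ᵇ M then 0 else maxTree k (suc n) x x)
    large x x≤n (inj₁ x<M) rewrite <⇒<ᵇ≡true x<M = refl
    large x x≤n (inj₂ M≤x) rewrite ≤⇒<ᵇ≡false M≤x | allowed-max l r x M≤x =
      trans (avoiders-tree k x (l ∷ r) (∷-bounded (l ∷ r) x≤n bd))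
        (trans (cong (λ m → maxTree k (suc n) m (b x m)) (m≥n⇒m⊔n≡m M≤x)) (cong (maxTree k (suc n) x) (b-max x)))

-- For a last letter `l < M`, the letters below `M` that may follow are those with `x ≤ l` for 2-01
-- and those with `l ≤ x` for 2-10. If `l` is the maximum, every smaller letter may follow.
b-2-u01 b-2-u10 : ℕ → ℕ → ℕ
b-2-u01 l M = if l <ᵇ M then suc l else M
b-2-u10 l M = if l <ᵇ M then M ∸ l else M

below-2-u01 : Below 2-u01 b-2-u01
below-2-u01 l r f = trans (∑-cong M (λ x x<M → pointwise x x<M (<-≤-connex l M))) (∑-< (λ x → f (suc x)) b≤M)
  where
  M = maximum (l ∷ r)
  b≤M : b-2-u01 l M ≤ M
  b≤M with <-≤-connex l M
  ... | inj₁ l<M rewrite <⇒<ᵇ≡true l<M = l<M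
  ... | inj₂ M≤l rewrite ≤⇒<ᵇ≡false M≤l = ≤-refl
  pointwise : ∀ x → x < M → l < M ⊎ M ≤ l → (if allowed 2-u01 (l ∷ r) x then f (b-2-u01 x M) else 0) ≡ (if x <ᵇ b-2-u01 l M then f (suc x) else 0)
  pointwise x x<M (inj₁ l<M) rewrite allowed-2-u01 l r x | <⇒<ᵇ≡true x<M | <⇒<ᵇ≡true l<M | ∧-identityʳ (l <ᵇ x) with <-≤-connex l x
  ... | inj₁ l<x rewrite <⇒<ᵇ≡true l<x | ≤⇒<ᵇ≡false l<x = refl
  ... | inj₂ x≤l rewrite ≤⇒<ᵇ≡false x≤l | <⇒<ᵇ≡true (s≤s x≤l) = refl
  pointwise x x<M (inj₂ M≤l) rewrite allowed-2-u01 l r x | <⇒<ᵇ≡true x<M | ≤⇒<ᵇ≡false M≤l | <⇒<ᵇ≡true x<M | ≤⇒<ᵇ≡false (≤-trans (<⇒≤ x<M) M≤l) = refl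

-- A permitted letter `x` below the maximum leads to the state `M ∸ x`; reflecting the interval
-- lists these states in the same order as for 2-01.
below-2-u10 : Below 2-u10 b-2-u10
below-2-u10 l r f = by-cases (<-≤-connex l M)
  where
  M = maximum (l ∷ r)
  by-cases : l < M ⊎ M ≤ l → ∑[ x < M ] (if allowed 2-u10 (l ∷ r) x then f (b-2-u10 x M) else 0) ≡ ∑[ t < b-2-u10 l M ] f (suc t)
  by-cases (inj₁ l<M) = trans (∑-cong M pointwise) (trans (∑-reflect M l f) (cong (λ m → ∑[ t < m ] f (suc t)) (sym eq-b)))
    where
    eq-b : b-2-u10 l M ≡ M ∸ l
    eq-b rewrite <⇒<ᵇ≡true l<M = refl
    pointwise : ∀ x → x < M → (if allowed 2-u10 (l ∷ r) x then f (b-2-u10 x M) else 0) ≡ (if x <ᵇ l then 0 else f (M ∸ x))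
    pointwise x x<M rewrite allowed-2-u10 l r x | <⇒<ᵇ≡true x<M | <⇒<ᵇ≡true l<M with x <ᵇ l
    ... | true  = refl
    ... | false = refl
  by-cases (inj₂ M≤l) = trans (∑-cong M pointwise) (trans (∑-reflect M 0 f) (cong (λ m → ∑[ t < m ] f (suc t)) (sym eq-b)))
    where
    eq-b : b-2-u10 l M ≡ M
    eq-b rewrite ≤⇒<ᵇ≡false M≤l = refl
    pointwise : ∀ x → x < M → (if allowed 2-u10 (l ∷ r) x then f (b-2-u10 x M) else 0) ≡ f (M ∸ x)
    pointwise x x<M rewrite allowed-2-u10 l r x | <⇒<ᵇ≡true x<M | ≤⇒<ᵇ≡false M≤l | ∧-zeroʳ (x <ᵇ l) = refl

2-u01~2-u10 : WilfEq 2-u01 2-u10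
2-u01~2-u10 zero    = refl
2-u01~2-u10 (suc n) = begin
  count 2-u01 (suc n) 0       ≡⟨ count-avoiders 2-u01 (suc n) ⟩
  avoiders 2-u01 n (0 ∷ [])   ≡⟨ MaxTree.avoiders-tree 2-u01 b-2-u01 b₁-max max₁ below-2-u01 n 0 [] (s≤s z≤n) ⟩
  maxTree n 1 0 0             ≡⟨ MaxTree.avoiders-tree 2-u10 b-2-u10 b₂-max max₂ below-2-u10 n 0 [] (s≤s z≤n) ⟨
  avoiders 2-u10 n (0 ∷ [])   ≡⟨ count-avoiders 2-u10 (suc n) ⟨
  count 2-u10 (suc n) 0       ∎
  where
  b₁-max : ∀ M → b-2-u01 M M ≡ M
  b₁-max M rewrite ≤⇒<ᵇ≡false (≤-refl {M}) = refl
  b₂-max : ∀ M → b-2-u10 M M ≡ M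
  b₂-max M rewrite ≤⇒<ᵇ≡false (≤-refl {M}) = refl
  max₁ : ∀ l r x → maximum (l ∷ r) ≤ x → allowed 2-u01 (l ∷ r) x ≡ true
  max₁ l r x M≤x rewrite allowed-2-u01 l r x | ≤⇒<ᵇ≡false M≤x = cong not (∧-zeroʳ (l <ᵇ x))
  max₂ : ∀ l r x → maximum (l ∷ r) ≤ x → allowed 2-u10 (l ∷ r) x ≡ true
  max₂ l r x M≤x rewrite allowed-2-u10 l r x | ≤⇒<ᵇ≡false (≤-trans (m≤m⊔n l (maximum r)) M≤x) = refl

-- The pair 1-01, 1-10: marked runs and their reversal.

copies : List ℕ → ℕ → ℕ
copies r x = ∑∈ r (λ z → bit (z ≡ᵇ x))

copies-↭ : ∀ {r s} x → r ↭ s → copies r x ≡ copies s x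
copies-↭ x r↭s = sum-↭ (map⁺ _ r↭s)

copies-∷ : ∀ {y x} r → y ≢ x → copies (y ∷ r) x ≡ copies r x
copies-∷ r y≢x rewrite ≢⇒≢ᵇ y≢x = refl

maximum-↭ : ∀ {r s} → r ↭ s → maximum r ≡ maximum s
maximum-↭ Perm.refl                   = refl
maximum-↭ (prep x p)                  = cong (x ⊔_) (maximum-↭ p)
maximum-↭ (swap {ys = s} x y p)       = trans (cong (λ m → x ⊔ (y ⊔ m)) (maximum-↭ p)) (x∙yz≈y∙xz ⊔-commutativeSemigroup x y (maximum s))
maximum-↭ (Perm.trans p p′)           = trans (maximum-↭ p) (maximum-↭ p′)

copies-or-≤ : ∀ r x → copies r x ≡ 0 ⊎ x ≤ maximum r
copies-or-≤ []      x = inj₁ refl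
copies-or-≤ (z ∷ r) x with <-cmp z x | copies-or-≤ r x
... | _            | inj₂ x≤ = inj₂ (≤-trans x≤ (m≤n⊔m z (maximum r)))
... | tri< z<x _ _ | inj₁ c  = inj₁ (trans (copies-∷ r (<⇒≢ z<x)) c)
... | tri≈ _ refl _ | inj₁ _ = inj₂ (m≤m⊔n z (maximum r))
... | tri> _ _ x<z | inj₁ _  = inj₂ (≤-trans (<⇒≤ x<z) (m≤m⊔n z (maximum r)))

-- The arguments are the number of letters still to be appended and the word so far.
Functional : Set
Functional = ℕ → List ℕ → ℕ

-- Dependence on the multiset of letters alone: this lets a marked run be reversed without affecting
-- what follows it.
Symmetric : Functional → Set
Symmetric h = ∀ k {r s} → r ↭ s → h k r ≡ h k s

infixl 6 _⊕_
_⊕_ : Functional → Functional → Functional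
(h ⊕ h′) k r = h k r + h′ k r

⊕-symmetric : ∀ {h h′} → Symmetric h → Symmetric h′ → Symmetric (h ⊕ h′)
⊕-symmetric s s′ k p = cong₂ _+_ (s k p) (s′ k p)

Upto : ℕ → Functional → Functional → Set
Upto k h h′ = ∀ j → j ≤ k → ∀ r → h j r ≡ h′ j r

-- Taking `q = suc q′` keeps `q ^ c` positive, so `q ^ c ∸ 1` is a true difference. Letters range
-- below `N`.
module Weighted (q′ N : ℕ) where

  q : ℕ
  q = suc q′

  -- m r x indicates that x may follow r. On inversion sequences maximum r ≤ length r and the condition
  -- is x ≤ length r; with the maximum the commutation lemmas hold for every word.
  m w : List ℕ → ℕ → ℕ
  m r x = bit (x <ᵇ suc (length r ⊔ maximum r))
  w r x = q ^ copies r x ∸ 1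

  m-↭ : ∀ {r s} x → r ↭ s → m r x ≡ m s x
  m-↭ x p = cong₂ (λ l M → bit (x <ᵇ suc (l ⊔ M))) (↭-length p) (maximum-↭ p)

  w-↭ : ∀ {r s} x → r ↭ s → w r x ≡ w s x
  w-↭ x p = cong (λ c → q ^ c ∸ 1) (copies-↭ x p)

  w-∷ : ∀ {y x} r → y ≢ x → w (y ∷ r) x ≡ w r x
  w-∷ r y≢x = cong (λ c → q ^ c ∸ 1) (copies-∷ r y≢x)

  w-zero : ∀ r x → copies r x ≡ 0 → w r x ≡ 0
  w-zero r x c rewrite c = refl

  m-one : ∀ r x → x ≤ maximum r → m r x ≡ 1
  m-one r x x≤ = cong bit (<⇒<ᵇ≡true (s≤s (≤-trans x≤ (m≤n⊔m (length r) (maximum r)))))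

  -- A nonzero weight requires an earlier copy of `x`; then `x` is at most the maximum and may
  -- certainly follow.
  m*w : ∀ r x → m r x * w r x ≡ w r x
  m*w r x with copies-or-≤ r x
  ... | inj₁ c  rewrite w-zero r x c = *-zeroʳ (m r x)
  ... | inj₂ x≤ rewrite m-one r x x≤ = *-identityˡ (w r x)

  q^copies : ∀ r x → q ^ copies r x ≡ suc (w r x)
  q^copies r x = sym (m+[n∸m]≡n (m^n>0 q (copies r x)))

  -- `M x` appends an unmarked and `D x` a marked letter before evaluating `h`; both vanish when no
  -- letter is left to append.
  M D : ℕ → Functional → Functional
  M x h zero    r = 0
  M x h (suc k) r = m r x * h k (x ∷ r)
  D x h zero    r = 0
  D x h (suc k) r = w r x * h k (x ∷ r)

  M-symmetric : ∀ x {h} → Symmetric h → Symmetric (M x h)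
  M-symmetric x s zero    p = refl
  M-symmetric x s (suc k) p = cong₂ _*_ (m-↭ x p) (s k (prep x p))

  D-symmetric : ∀ x {h} → Symmetric h → Symmetric (D x h)
  D-symmetric x s zero    p = refl
  D-symmetric x s (suc k) p = cong₂ _*_ (w-↭ x p) (s k (prep x p))

  M-upto : ∀ x {k h h′} → Upto k h h′ → Upto (suc k) (M x h) (M x h′)
  M-upto x e zero    _         r = refl
  M-upto x e (suc j) (s≤s j≤k) r = cong (m r x *_) (e j j≤k (x ∷ r))

  D-upto : ∀ x {k h h′} → Upto k h h′ → Upto (suc k) (D x h) (D x h′)
  D-upto x e zero    _         r = refl
  D-upto x e (suc j) (s≤s j≤k) r = cong (w r x *_) (e j j≤k (x ∷ r))

  D-cong : ∀ x {h h′} → (∀ k r → h k r ≡ h′ k r) → ∀ k r → D x h k r ≡ D x h′ k r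
  D-cong x e zero    r = refl
  D-cong x e (suc k) r = cong (w r x *_) (e k (x ∷ r))

  M-⊕ : ∀ x h h′ k r → M x (h ⊕ h′) k r ≡ M x h k r + M x h′ k r
  M-⊕ x h h′ zero    r = refl
  M-⊕ x h h′ (suc k) r = *-distribˡ-+ (m r x) _ _

  D-⊕ : ∀ x h h′ k r → D x (h ⊕ h′) k r ≡ D x h k r + D x h′ k r
  D-⊕ x h h′ zero    r = refl
  D-⊕ x h h′ (suc k) r = *-distribˡ-+ (w r x) _ _

  D-D : ∀ {x y} h → x ≢ y → Symmetric h → ∀ k r → D x (D y h) k r ≡ D y (D x h) k r
  D-D h x≢y s zero          r = refl
  D-D {x} {y} h x≢y s (suc zero)    r = trans (*-zeroʳ (w r x)) (sym (*-zeroʳ (w r y)))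
  D-D {x} {y} h x≢y s (suc (suc k)) r rewrite w-∷ r x≢y | w-∷ {y} {x} r (x≢y ∘ sym) =
    trans (cong (λ z → w r x * (w r y * z)) (s k (swap y x ↭-refl))) (x∙yz≈y∙xz *-commutativeSemigroup (w r x) (w r y) _)

  -- If `y` has no earlier copy, both sides vanish. Otherwise the maximum is at least `y > x`, so
  -- `x` is admissible before as well as after `y`.
  M-D : ∀ {x y} h → x < y → Symmetric h → ∀ k r → M x (D y h) k r ≡ D y (M x h) k r
  M-D h x<y s zero          r = refl
  M-D {x} {y} h x<y s (suc zero)    r = trans (*-zeroʳ (m r x)) (sym (*-zeroʳ (w r y)))
  M-D {x} {y} h x<y s (suc (suc k)) r rewrite w-∷ r (<⇒≢ x<y) with copies-or-≤ r y
  ... | inj₁ c  rewrite w-zero r y c = *-zeroʳ (m r x)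
  ... | inj₂ y≤ rewrite m-one r x (<⇒≤ (<-≤-trans x<y y≤)) | m-one (y ∷ r) x (≤-trans (<⇒≤ (<-≤-trans x<y y≤)) (m≤n⊔m y (maximum r))) =
    trans (*-identityˡ _) (cong (w r y *_) (trans (s k (swap y x ↭-refl)) (sym (*-identityˡ _))))

  -- Z sums over the chains of letters < n written in decreasing order, the last letter unmarked (M) and
  -- the others marked (D); V sums over those written in increasing order, the first letter unmarked.
  Z : ℕ → Functional → Functional
  Z zero    h k r = 0
  Z (suc n) h     = Z n h ⊕ D n (Z n h) ⊕ M n h

  -- Sums over the increasing runs, possibly empty, of marked letters strictly between `l` and the
  -- bound. The largest letter is innermost because the innermost operator appends last.
  ascending : ℕ → ℕ → Functional → Functional
  ascending l zero    h = h
  ascending l (suc n) h = ascending l n (if l <ᵇ n then h ⊕ D n h else h)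

  V : ℕ → Functional → Functional
  V n h k r = ∑[ x < n ] M x (ascending x n h) k r

  Z-symmetric : ∀ n {h} → Symmetric h → Symmetric (Z n h)
  Z-symmetric zero    s k p = refl
  Z-symmetric (suc n) s k p = cong₂ _+_ (cong₂ _+_ (Z-symmetric n s k p) (D-symmetric n (Z-symmetric n s) k p)) (M-symmetric n s k p)

  Z-upto : ∀ n {k h h′} → Upto k h h′ → Upto (suc k) (Z n h) (Z n h′)
  Z-upto zero    e j j≤ r = refl
  Z-upto (suc n) e j j≤ r = cong₂ _+_ (cong₂ _+_ (Z-upto n e j j≤ r)
    (D-upto n (Z-upto n e) j (m≤n⇒m≤1+n j≤) r)) (M-upto n e j j≤ r)

  ascending-upto : ∀ l n {k h h′} → Upto k h h′ → Upto k (ascending l n h) (ascending l n h′)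
  ascending-upto l zero    e = e
  ascending-upto l (suc n) e with l <ᵇ n
  ... | true  = ascending-upto l n (λ j j≤ r → cong₂ _+_ (e j j≤ r) (D-upto n e j (m≤n⇒m≤1+n j≤) r))
  ... | false = ascending-upto l n e

  V-upto : ∀ n {k h h′} → Upto k h h′ → Upto (suc k) (V n h) (V n h′)
  V-upto n e j j≤ r = ∑-cong n (λ x _ → M-upto x (ascending-upto x n e) j j≤ r)

  Z-⊕ : ∀ n h h′ k r → Z n (h ⊕ h′) k r ≡ Z n h k r + Z n h′ k r
  Z-⊕ zero    h h′ k r = refl
  Z-⊕ (suc n) h h′ k r = begin
    Z n (h ⊕ h′) k r + D n (Z n (h ⊕ h′)) k r + M n (h ⊕ h′) k r
      ≡⟨ cong₂ _+_ (cong₂ _+_ (Z-⊕ n h h′ k r)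
           (trans (D-cong n (Z-⊕ n h h′) k r) (D-⊕ n (Z n h) (Z n h′) k r))) (M-⊕ n h h′ k r) ⟩
    Z n h k r + Z n h′ k r + (D n (Z n h) k r + D n (Z n h′) k r) + (M n h k r + M n h′ k r)
      ≡⟨ cong (_+ (M n h k r + M n h′ k r)) (interchange +-commutativeSemigroup (Z n h k r) _ _ _) ⟩
    Z n h k r + D n (Z n h) k r + (Z n h′ k r + D n (Z n h′) k r) + (M n h k r + M n h′ k r)
      ≡⟨ interchange +-commutativeSemigroup (Z n h k r + D n (Z n h) k r) _ _ _ ⟩
    Z (suc n) h k r + Z (suc n) h′ k r ∎

  -- All letters in the chains of `Z n` are below `n ≤ y`, so a marked `y` commutes with each of
  -- them by `D-D` and `M-D`.
  Z-D : ∀ n {y} h → n ≤ y → Symmetric h → ∀ k r → Z n (D y h) k r ≡ D y (Z n h) k r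
  Z-D zero    {y} h n≤y s zero    r = refl
  Z-D zero    {y} h n≤y s (suc k) r = sym (*-zeroʳ (w r y))
  Z-D (suc n) {y} h n<y s k r = begin
    Z n (D y h) k r + D n (Z n (D y h)) k r + M n (D y h) k r
      ≡⟨ cong₂ _+_ (cong₂ _+_ (Z-D n h (<⇒≤ n<y) s k r)
           (trans (D-cong n (Z-D n h (<⇒≤ n<y) s) k r) (D-D (Z n h) (<⇒≢ n<y) (Z-symmetric n s) k r)))
           (M-D h n<y s k r) ⟩
    D y (Z n h) k r + D y (D n (Z n h)) k r + D y (M n h) k r
      ≡⟨ cong (_+ D y (M n h) k r) (D-⊕ y (Z n h) (D n (Z n h)) k r) ⟨
    D y (Z n h ⊕ D n (Z n h)) k r + D y (M n h) k r
      ≡⟨ D-⊕ y (Z n h ⊕ D n (Z n h)) (M n h) k r ⟨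
    D y (Z (suc n) h) k r ∎

  ascending-trivial : ∀ l n h → n ≤ suc l → ascending l n h ≡ h
  ascending-trivial l zero    h _         = refl
  ascending-trivial l (suc n) h (s≤s n≤l) rewrite ≤⇒<ᵇ≡false n≤l = ascending-trivial l n h (m≤n⇒m≤1+n n≤l)

  -- Reversal of runs, by induction on the alphabet. In a chain of several letters, `n` comes last
  -- when they increase and first when they decrease; `Z-D` carries it from one end to the other.
  V≡Z : ∀ n h → Symmetric h → ∀ k r → V n h k r ≡ Z n h k r
  V≡Z zero    h s k r = refl
  V≡Z (suc n) h s k r = begin
    (∑[ x < n ] M x (ascending x (suc n) h) k r) + M n (ascending n (suc n) h) k r
      ≡⟨ cong₂ _+_ (∑-cong n (λ x x<n → cong (λ b → M x (ascending x n (if b then h ⊕ D n h else h)) k r) (<⇒<ᵇ≡true x<n)))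
                   (cong (λ h′ → M n h′ k r) (ascending-trivial n (suc n) h ≤-refl)) ⟩
    V n (h ⊕ D n h) k r + M n h k r
      ≡⟨ cong (_+ M n h k r) (V≡Z n (h ⊕ D n h) (⊕-symmetric s (D-symmetric n s)) k r) ⟩
    Z n (h ⊕ D n h) k r + M n h k r
      ≡⟨ cong (_+ M n h k r) (trans (Z-⊕ n h (D n h) k r) (cong (Z n h k r +_) (Z-D n h ≤-refl s k r))) ⟩
    Z (suc n) h k r ∎

  -- The definition splits off the largest letter of a run; here the run is expanded by its first
  -- letter, as `run` requires.
  ascending-unfold : ∀ l n h k r →
    ascending l n h k r ≡ h k r + ∑[ x < n ] (if l <ᵇ x then D x (ascending x n h) k r else 0)
  ascending-unfold l zero    h k r = sym (+-identityʳ _)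
  ascending-unfold l (suc n) h k r = begin
    ascending l n (if l <ᵇ n then h ⊕ D n h else h) k r
      ≡⟨ by-cases (<-≤-connex l n) ⟩
    h k r + ((∑[ x < n ] (if l <ᵇ x then D x (ascending x (suc n) h) k r else 0)) + (if l <ᵇ n then D n h k r else 0))
      ≡⟨ cong (λ h′ → h k r + ((∑[ x < n ] (if l <ᵇ x then D x (ascending x (suc n) h) k r else 0)) + (if l <ᵇ n then D n h′ k r else 0)))
           (ascending-trivial n (suc n) h ≤-refl) ⟨
    h k r + (∑[ x < suc n ] (if l <ᵇ x then D x (ascending x (suc n) h) k r else 0)) ∎
    where
    by-cases : l < n ⊎ n ≤ l → ascending l n (if l <ᵇ n then h ⊕ D n h else h) k r ≡
      h k r + ((∑[ x < n ] (if l <ᵇ x then D x (ascending x (suc n) h) k r else 0)) + (if l <ᵇ n then D n h k r else 0))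
    by-cases (inj₁ l<n) rewrite <⇒<ᵇ≡true l<n = begin
      ascending l n (h ⊕ D n h) k r
        ≡⟨ ascending-unfold l n (h ⊕ D n h) k r ⟩
      h k r + D n h k r + ∑[ x < n ] (if l <ᵇ x then D x (ascending x n (h ⊕ D n h)) k r else 0)
        ≡⟨ cong (h k r + D n h k r +_) (∑-cong n (λ x x<n → cong (λ b → if l <ᵇ x then D x (ascending x n (if b then h ⊕ D n h else h)) k r else 0)
             (sym (<⇒<ᵇ≡true x<n)))) ⟩
      h k r + D n h k r + ∑[ x < n ] (if l <ᵇ x then D x (ascending x (suc n) h) k r else 0)
        ≡⟨ trans (+-assoc (h k r) _ _) (cong (h k r +_) (+-comm (D n h k r) _)) ⟩
      h k r + (∑[ x < n ] (if l <ᵇ x then D x (ascending x (suc n) h) k r else 0) + D n h k r) ∎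
    by-cases (inj₂ n≤l) rewrite ≤⇒<ᵇ≡false n≤l = trans (cong (λ h′ → h′ k r) (ascending-trivial l n h (m≤n⇒m≤1+n n≤l)))
      (trans (sym (+-identityʳ _)) (cong (h k r +_) (sym (trans (+-identityʳ _)
        (∑-zero n (λ x x<n → cong (λ b → if b then D x (ascending x (suc n) h) k r else 0) (≤⇒<ᵇ≡false (≤-trans (<⇒≤ x<n) n≤l))))))))

  -- free omits the weight of the first new letter.
  run free : (List ℕ → ℕ → ℕ) → Functional
  run s zero    r = 1
  run s (suc k) r = ∑[ x < N ] (m r x * (q ^ s r x * run s k (x ∷ r)))
  free s zero    r = 1
  free s (suc k) r = ∑[ x < N ] M x (run s) (suc k) r

  -- Exponents for 1-01 and 1-10. On an ascent the larger letter is the new `x`, counted in the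
  -- whole word; on a descent it is `l`, counted in the word before it. Either way `q ^ c` is one
  -- more than the weight `w` of the larger letter on arrival.
  asc des : List ℕ → ℕ → ℕ
  asc []      x = 0
  asc (l ∷ r) x = if l <ᵇ x then copies (l ∷ r) x else 0
  des []      x = 0
  des (l ∷ r) x = if x <ᵇ l then copies r l else 0

  run-[] : ∀ s → (∀ x → s [] x ≡ 0) → ∀ k → run s k [] ≡ free s k []
  run-[] s s[] zero    = refl
  run-[] s s[] (suc k) = ∑-cong N (λ x _ → cong (m [] x *_) (trans (cong (λ e → q ^ e * run s k (x ∷ [])) (s[] x)) (*-identityˡ _)))

  -- At each ascent `q ^ c` splits as `1 + w`: the summand 1 ends the marked run, the summand `w`
  -- marks `x` and continues the run above it.
  run-asc : ∀ k l r → run asc k (l ∷ r) ≡ ascending l N (free asc) k (l ∷ r)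
  run-asc zero    l r = sym (trans (ascending-unfold l N (free asc) 0 (l ∷ r)) (cong suc (∑-zero N (λ x _ → if-zero (l <ᵇ x)))))
    where
    if-zero : ∀ b → (if b then 0 else 0) ≡ 0
    if-zero true  = refl
    if-zero false = refl
  run-asc (suc k) l r = begin
    (∑[ x < N ] (m s x * (q ^ asc s x * run asc k (x ∷ s))))
      ≡⟨ ∑-cong N (λ x _ → pointwise x) ⟩
    (∑[ x < N ] (M x (run asc) (suc k) s + (if l <ᵇ x then D x (ascending x N (free asc)) (suc k) s else 0)))
      ≡⟨ ∑-+ N _ _ ⟩
    free asc (suc k) s + (∑[ x < N ] (if l <ᵇ x then D x (ascending x N (free asc)) (suc k) s else 0))
      ≡⟨ ascending-unfold l N (free asc) (suc k) s ⟨
    ascending l N (free asc) (suc k) s ∎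
    where
    s = l ∷ r
    pointwise : ∀ x → m s x * (q ^ asc s x * run asc k (x ∷ s)) ≡
      M x (run asc) (suc k) s + (if l <ᵇ x then D x (ascending x N (free asc)) (suc k) s else 0)
    pointwise x with l <ᵇ x
    ... | false = trans (cong (m s x *_) (*-identityˡ _)) (sym (+-identityʳ _))
    ... | true  = begin
      m s x * (q ^ copies s x * run asc k (x ∷ s))                       ≡⟨ cong (λ e → m s x * (e * run asc k (x ∷ s))) (q^copies s x) ⟩
      m s x * (run asc k (x ∷ s) + w s x * run asc k (x ∷ s))            ≡⟨ *-distribˡ-+ (m s x) _ _ ⟩
      m s x * run asc k (x ∷ s) + m s x * (w s x * run asc k (x ∷ s))    ≡⟨ cong (m s x * run asc k (x ∷ s) +_) (trans
        (sym (*-assoc (m s x) (w s x) _)) (cong₂ _*_ (m*w s x) (run-asc k x s))) ⟩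
      m s x * run asc k (x ∷ s) + w s x * ascending x N (free asc) k (x ∷ s) ∎

  free-asc : ∀ k r → free asc (suc k) r ≡ V N (free asc) (suc k) r
  free-asc k r = ∑-cong N (λ x _ → cong (m r x *_) (run-asc k x r))

  -- On a descent the mark belongs to `l`, which is already placed, so its weight `w r l` factors
  -- out of the sum over the smaller next letters.
  run-des : ∀ k l r → l < N → run des k (l ∷ r) ≡ free des k (l ∷ r) + w r l * ∑[ x < l ] M x (run des) k (l ∷ r)
  run-des zero    l r l<N = cong suc (sym (trans (cong (w r l *_) (∑-zero l (λ _ _ → refl))) (*-zeroʳ (w r l))))
  run-des (suc k) l r l<N = begin
    (∑[ x < N ] (m s x * (q ^ des s x * run des k (x ∷ s))))
      ≡⟨ ∑-cong N (λ x _ → pointwise x) ⟩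
    (∑[ x < N ] (M x (run des) (suc k) s + w r l * (if x <ᵇ l then M x (run des) (suc k) s else 0)))
      ≡⟨ ∑-+ N _ _ ⟩
    free des (suc k) s + (∑[ x < N ] (w r l * (if x <ᵇ l then M x (run des) (suc k) s else 0)))
      ≡⟨ cong (free des (suc k) s +_) (trans (∑-*ˡ N (w r l) _) (cong (w r l *_) (∑-< (λ x → M x (run des) (suc k) s) (<⇒≤ l<N)))) ⟩
    free des (suc k) s + w r l * (∑[ x < l ] M x (run des) (suc k) s) ∎
    where
    s = l ∷ r
    pointwise : ∀ x → m s x * (q ^ des s x * run des k (x ∷ s)) ≡
      M x (run des) (suc k) s + w r l * (if x <ᵇ l then M x (run des) (suc k) s else 0)
    pointwise x with x <ᵇ l
    ... | false = trans (cong (m s x *_) (*-identityˡ _)) (trans (sym (+-identityʳ _)) (cong (m s x * run des k (x ∷ s) +_) (sym (*-zeroʳ (w r l)))))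
    ... | true  = begin
      m s x * (q ^ copies r l * run des k (x ∷ s))                       ≡⟨ cong (λ e → m s x * (e * run des k (x ∷ s))) (q^copies r l) ⟩
      m s x * (run des k (x ∷ s) + w r l * run des k (x ∷ s))            ≡⟨ *-distribˡ-+ (m s x) _ _ ⟩
      m s x * run des k (x ∷ s) + m s x * (w r l * run des k (x ∷ s))    ≡⟨ cong (m s x * run des k (x ∷ s) +_) (x∙yz≈y∙xz *-commutativeSemigroup (m s x) (w r l) _) ⟩
      m s x * run des k (x ∷ s) + w r l * (m s x * run des k (x ∷ s))    ∎

  -- A run starting with `n` either stops there unmarked or marks `n` and continues below it: these
  -- are the last two terms of `Z (suc n)`.
  ∑-run-des : ∀ n → n ≤ N → ∀ k r → ∑[ x < n ] M x (run des) k r ≡ Z n (free des) k r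
  ∑-run-des zero    _   k       r = refl
  ∑-run-des (suc n) n<N zero    r = trans (+-identityʳ _) (trans (∑-run-des n (<⇒≤ n<N) 0 r) (sym (trans (+-identityʳ _) (+-identityʳ _))))
  ∑-run-des (suc n) n<N (suc k) r = begin
    (∑[ x < n ] M x (run des) (suc k) r) + m r n * run des k (n ∷ r)
      ≡⟨ cong₂ _+_ (∑-run-des n (<⇒≤ n<N) (suc k) r) last ⟩
    Z n (free des) (suc k) r + (D n (Z n (free des)) (suc k) r + M n (free des) (suc k) r)
      ≡⟨ +-assoc (Z n (free des) (suc k) r) _ _ ⟨
    Z (suc n) (free des) (suc k) r ∎
    where
    last : m r n * run des k (n ∷ r) ≡ w r n * Z n (free des) k (n ∷ r) + m r n * free des k (n ∷ r)
    last = begin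
      m r n * run des k (n ∷ r)
        ≡⟨ cong (m r n *_) (run-des k n r n<N) ⟩
      m r n * (free des k (n ∷ r) + w r n * ∑[ x < n ] M x (run des) k (n ∷ r))
        ≡⟨ trans (*-distribˡ-+ (m r n) _ _) (+-comm (m r n * free des k (n ∷ r)) _) ⟩
      m r n * (w r n * ∑[ x < n ] M x (run des) k (n ∷ r)) + m r n * free des k (n ∷ r)
        ≡⟨ cong (_+ m r n * free des k (n ∷ r)) (trans (sym (*-assoc (m r n) (w r n) _))
             (cong₂ _*_ (m*w r n) (∑-run-des n (<⇒≤ n<N) k (n ∷ r)))) ⟩
      w r n * Z n (free des) k (n ∷ r) + m r n * free des k (n ∷ r) ∎

  -- Approximants to a common solution of the recursions for `free asc` and `free des`. Every chain
  -- uses a letter, so `fuel` at least the number of remaining letters suffices. They are symmetric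
  -- by construction, as `V≡Z` requires.
  chains : ℕ → Functional
  chains zero       k       r = 1
  chains (suc fuel) zero    r = 1
  chains (suc fuel) (suc k) r = Z N (chains fuel) (suc k) r

  chains-symmetric : ∀ fuel → Symmetric (chains fuel)
  chains-symmetric zero       k       p = refl
  chains-symmetric (suc fuel) zero    p = refl
  chains-symmetric (suc fuel) (suc k) p = Z-symmetric N (chains-symmetric fuel) (suc k) p

  free-asc-chains : ∀ fuel → Upto fuel (free asc) (chains fuel)
  free-asc-chains zero       zero    _         r = refl
  free-asc-chains (suc fuel) zero    _         r = refl
  free-asc-chains (suc fuel) (suc k) (s≤s k≤) r = begin
    free asc (suc k) r              ≡⟨ free-asc k r ⟩
    V N (free asc) (suc k) r        ≡⟨ V-upto N (free-asc-chains fuel) (suc k) (s≤s k≤) r ⟩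
    V N (chains fuel) (suc k) r     ≡⟨ V≡Z N (chains fuel) (chains-symmetric fuel) (suc k) r ⟩
    Z N (chains fuel) (suc k) r     ∎

  free-des-chains : ∀ fuel → Upto fuel (free des) (chains fuel)
  free-des-chains zero       zero    _         r = refl
  free-des-chains (suc fuel) zero    _         r = refl
  free-des-chains (suc fuel) (suc k) (s≤s k≤) r = begin
    free des (suc k) r              ≡⟨ ∑-run-des N ≤-refl (suc k) r ⟩
    Z N (free des) (suc k) r        ≡⟨ Z-upto N (free-des-chains fuel) (suc k) (s≤s k≤) r ⟩
    Z N (chains fuel) (suc k) r     ∎

  run-asc≡run-des : ∀ k → run asc k [] ≡ run des k []
  run-asc≡run-des k = begin
    run asc k []    ≡⟨ run-[] asc (λ _ → refl) k ⟩
    free asc k []   ≡⟨ free-asc-chains k k ≤-refl [] ⟩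
    chains k k []   ≡⟨ free-des-chains k k ≤-refl [] ⟨
    free des k []   ≡⟨ run-[] des (λ _ → refl) k ⟨
    run des k []    ∎

  -- The bound on the maximum makes `m` the condition `x ≤ length r`, and `k + length r ≤ N` keeps
  -- all these letters below `N`.
  total-run : ∀ p s → (∀ r x → new p r x ≡ s r x) → ∀ k r → maximum r ≤ length r → k + length r ≤ N →
    total k (λ r → q ^ occ p r) r ≡ q ^ occ p r * run s k r
  total-run p s new≡ zero    r M≤ k≤ = sym (*-identityʳ _)
  total-run p s new≡ (suc k) r M≤ k≤ = begin
    (∑[ x < suc n ] total k (λ r → q ^ occ p r) (x ∷ r))
      ≡⟨ ∑-cong (suc n) (λ x x≤n → step x (≤-pred x≤n)) ⟩
    (∑[ x < suc n ] (q ^ occ p r * (q ^ s r x * run s k (x ∷ r))))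
      ≡⟨ ∑-*ˡ (suc n) (q ^ occ p r) _ ⟩
    q ^ occ p r * (∑[ x < suc n ] (q ^ s r x * run s k (x ∷ r)))
      ≡⟨ cong (q ^ occ p r *_) (∑-< (λ x → q ^ s r x * run s k (x ∷ r)) (≤-trans (s≤s (m≤n+m n k)) k≤)) ⟨
    q ^ occ p r * (∑[ x < N ] (if x <ᵇ suc n then q ^ s r x * run s k (x ∷ r) else 0))
      ≡⟨ cong (q ^ occ p r *_) (∑-cong N (λ x _ → trans (if-* (x <ᵇ suc n) _)
           (cong (λ l → bit (x <ᵇ suc l) * (q ^ s r x * run s k (x ∷ r))) (sym (m≥n⇒m⊔n≡m M≤))))) ⟩
    q ^ occ p r * (∑[ x < N ] (m r x * (q ^ s r x * run s k (x ∷ r)))) ∎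
    where
    n = length r
    if-* : ∀ b e → (if b then e else 0) ≡ bit b * e
    if-* true  e = sym (*-identityˡ e)
    if-* false e = refl
    step : ∀ x → x ≤ n → total k (λ r → q ^ occ p r) (x ∷ r) ≡ q ^ occ p r * (q ^ s r x * run s k (x ∷ r))
    step x x≤n = begin
      total k (λ r → q ^ occ p r) (x ∷ r)
        ≡⟨ total-run p s new≡ k (x ∷ r) (⊔-lub (m≤n⇒m≤1+n x≤n) (m≤n⇒m≤1+n M≤)) (≤-trans (≤-reflexive (+-suc k n)) k≤) ⟩
      q ^ (occ p r + new p r x) * run s k (x ∷ r)
        ≡⟨ cong (_* run s k (x ∷ r)) (trans (^-distribˡ-+-* q (occ p r) (new p r x)) (cong (λ e → q ^ occ p r * q ^ e) (new≡ r x))) ⟩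
      q ^ occ p r * q ^ s r x * run s k (x ∷ r)
        ≡⟨ *-assoc (q ^ occ p r) _ _ ⟩
      q ^ occ p r * (q ^ s r x * run s k (x ∷ r)) ∎

  new-1-u01 : ∀ r x → new 1-u01 r x ≡ asc r x
  new-1-u01 []      x = refl
  new-1-u01 (l ∷ r) x = trans (∑∈-cong r (λ z → cong bit (match-1-u01 z l x))) (by-cases (<-≤-connex l x))
    where
    by-cases : l < x ⊎ x ≤ l → ∑∈ r (λ z → bit ((l <ᵇ x) ∧ (z ≡ᵇ x))) ≡ asc (l ∷ r) x
    by-cases (inj₁ l<x) rewrite <⇒<ᵇ≡true l<x = sym (copies-∷ r (<⇒≢ l<x))
    by-cases (inj₂ x≤l) rewrite ≤⇒<ᵇ≡false x≤l = ∑∈-zero r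

  new-1-u10 : ∀ r x → new 1-u10 r x ≡ des r x
  new-1-u10 []      x = refl
  new-1-u10 (l ∷ r) x = trans (∑∈-cong r (λ z → cong bit (match-1-u10 z l x))) by-cases
    where
    by-cases : ∑∈ r (λ z → bit ((x <ᵇ l) ∧ (z ≡ᵇ l))) ≡ des (l ∷ r) x
    by-cases with x <ᵇ l
    ... | true  = refl
    ... | false = ∑∈-zero r

generating-function : ∀ q′ n → ∑∈ (allInv n) (λ e → suc q′ ^ oc 1-u01 e) ≡ ∑∈ (allInv n) (λ e → suc q′ ^ oc 1-u10 e)
generating-function q′ n = begin
  ∑∈ (allInv n) (λ e → q ^ oc 1-u01 e)   ≡⟨ unfold 1-u01 asc new-1-u01 ⟩
  run asc n []                           ≡⟨ run-asc≡run-des n ⟩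
  run des n []                           ≡⟨ unfold 1-u10 des new-1-u10 ⟨
  ∑∈ (allInv n) (λ e → q ^ oc 1-u10 e)   ∎
  where
  open Weighted q′ n
  unfold : ∀ p s → (∀ r x → new p r x ≡ s r x) → ∑∈ (allInv n) (λ e → q ^ oc p e) ≡ run s n []
  unfold p s new≡ = begin
    ∑∈ (allInv n) (λ e → q ^ oc p e)             ≡⟨ ∑-allInv n _ ⟩
    total n (λ r → q ^ oc p (reverse r)) []      ≡⟨ total-cong n (λ r → cong (q ^_) (oc-reverse p r)) [] ⟩
    total n (λ r → q ^ occ p r) []               ≡⟨ total-run p s new≡ n [] z≤n (≤-reflexive (+-identityʳ n)) ⟩
    1 * run s n []                               ≡⟨ *-identityˡ _ ⟩
    run s n []                                   ∎

-- Multiplicities of exponents recovered from the sum of powers.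

lower : List ℕ → List ℕ
lower []          = []
lower (zero  ∷ L) = lower L
lower (suc s ∷ L) = s ∷ lower L

length-lower : ∀ L → length (lower L) ≤ length L
length-lower []          = z≤n
length-lower (zero  ∷ L) = m≤n⇒m≤1+n (length-lower L)
length-lower (suc s ∷ L) = s≤s (length-lower L)

copies-lower : ∀ L m → copies L (suc m) ≡ copies (lower L) m
copies-lower []          m = refl
copies-lower (zero  ∷ L) m = copies-lower L m
copies-lower (suc s ∷ L) m = cong (bit (s ≡ᵇ m) +_) (copies-lower L m)

copies-≤ : ∀ L m → copies L m ≤ length L
copies-≤ []      m = z≤n
copies-≤ (s ∷ L) m with s ≡ᵇ m
... | true  = s≤s (copies-≤ L m)
... | false = m≤n⇒m≤1+n (copies-≤ L m)

-- Division by `q` with remainder at the level of exponents: zeros form the lowest digit, the others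
-- lose one factor `q`.
∑-^-lower : ∀ q L → ∑∈ L (q ^_) ≡ copies L 0 + ∑∈ (lower L) (q ^_) * q
∑-^-lower q []          = refl
∑-^-lower q (zero  ∷ L) = cong suc (∑-^-lower q L)
∑-^-lower q (suc s ∷ L) = begin
  q * q ^ s + ∑∈ L (q ^_)                                     ≡⟨ cong₂ _+_ (*-comm q (q ^ s)) (∑-^-lower q L) ⟩
  q ^ s * q + (copies L 0 + ∑∈ (lower L) (q ^_) * q)          ≡⟨ +-assoc (q ^ s * q) (copies L 0) _ ⟨
  q ^ s * q + copies L 0 + ∑∈ (lower L) (q ^_) * q            ≡⟨ cong (_+ ∑∈ (lower L) (q ^_) * q) (+-comm (q ^ s * q) (copies L 0)) ⟩
  copies L 0 + q ^ s * q + ∑∈ (lower L) (q ^_) * q            ≡⟨ +-assoc (copies L 0) (q ^ s * q) _ ⟩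
  copies L 0 + (q ^ s * q + ∑∈ (lower L) (q ^_) * q)          ≡⟨ cong (copies L 0 +_) (*-distribʳ-+ q (q ^ s) _) ⟨
  copies L 0 + (q ^ s + ∑∈ (lower L) (q ^_)) * q              ∎

lowest-digit : ∀ q′ {a b x y} → let q = suc q′ in a < q → b < q → a + x * q ≡ b + y * q → a ≡ b
lowest-digit q′ {a} {b} {x} {y} a<q b<q e = begin
  a                          ≡⟨ m<n⇒m%n≡m a<q ⟨
  a % suc q′                 ≡⟨ [m+kn]%n≡m%n a x (suc q′) ⟨
  (a + x * suc q′) % suc q′  ≡⟨ cong (_% suc q′) e ⟩
  (b + y * suc q′) % suc q′  ≡⟨ [m+kn]%n≡m%n b y (suc q′) ⟩
  b % suc q′                 ≡⟨ m<n⇒m%n≡m b<q ⟩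
  b                          ∎

-- For q exceeding both lengths, the multiplicities are the base-q digits of ∑ q ^ s.
copies-determined : ∀ m q′ L L′ → length L < suc q′ → length L′ < suc q′ →
  ∑∈ L (suc q′ ^_) ≡ ∑∈ L′ (suc q′ ^_) → copies L m ≡ copies L′ m
copies-determined m q′ L L′ L< L′< e = go m
  where
  q = suc q′
  e′ : copies L 0 + ∑∈ (lower L) (q ^_) * q ≡ copies L′ 0 + ∑∈ (lower L′) (q ^_) * q
  e′ = trans (sym (∑-^-lower q L)) (trans e (∑-^-lower q L′))
  zeros : copies L 0 ≡ copies L′ 0
  zeros = lowest-digit q′ {x = ∑∈ (lower L) (q ^_)} {y = ∑∈ (lower L′) (q ^_)} (≤-<-trans (copies-≤ L 0) L<) (≤-<-trans (copies-≤ L′ 0) L′<) e′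
  rest : ∑∈ (lower L) (q ^_) ≡ ∑∈ (lower L′) (q ^_)
  rest = *-cancelʳ-≡ _ _ q (+-cancelˡ-≡ (copies L 0) _ _ (trans e′ (cong (_+ ∑∈ (lower L′) (q ^_) * q) (sym zeros))))
  go : ∀ m → copies L m ≡ copies L′ m
  go zero    = zeros
  go (suc m) = trans (copies-lower L m) (trans
    (copies-determined m q′ (lower L) (lower L′) (≤-<-trans (length-lower L) L<) (≤-<-trans (length-lower L′) L′<) rest)
    (sym (copies-lower L′ m)))

count-copies : ∀ p n m → count p n m ≡ copies (map (oc p) (allInv n)) m
count-copies p n m = trans (length-filterᵇ (λ e → does (oc p e ≟ m)) (allInv n)) (sym (∑∈-map (oc p) (allInv n) _))

1-u01~1-u10 : StronglyWilfEq 1-u01 1-u10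
1-u01~1-u10 n m = begin
  count 1-u01 n m                           ≡⟨ count-copies 1-u01 n m ⟩
  copies (map (oc 1-u01) (allInv n)) m      ≡⟨ copies-determined m q′ (map (oc 1-u01) (allInv n)) (map (oc 1-u10) (allInv n))
    (s≤s (≤-reflexive (length-map (oc 1-u01) (allInv n)))) (s≤s (≤-reflexive (length-map (oc 1-u10) (allInv n))))
    (trans (∑∈-map (oc 1-u01) (allInv n) _) (trans (generating-function q′ n) (sym (∑∈-map (oc 1-u10) (allInv n) _)))) ⟩
  copies (map (oc 1-u10) (allInv n)) m      ≡⟨ count-copies 1-u10 n m ⟨
  count 1-u10 n m                           ∎
  -- With this choice `q` exceeds the number of exponents on either side, as reading off digits
  -- requires.
  where q′ = length (allInv n)

-- Failure of the stronger equivalences, by evaluation.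

u01-0≁u01-1 : ¬ StronglyWilfEq u01-0 u01-1
u01-0≁u01-1 h with () ← h 5 1

u10-0≁u10-1 : ¬ StronglyWilfEq u10-0 u10-1
u10-0≁u10-1 h with () ← h 6 1

-- total with the number of occurrences so far carried along, for evaluation.
tally : HVPattern → ℕ → ℕ → ℕ → List ℕ → ℕ
tally p m zero    o r = bit (o ≡ᵇ m)
tally p m (suc k) o r = ∑[ x < suc (length r) ] tally p m k (o + new p r x) (x ∷ r)

total-tally : ∀ p m k r → total k (λ r → bit (occ p r ≡ᵇ m)) r ≡ tally p m k (occ p r) r
total-tally p m zero    r = refl
total-tally p m (suc k) r = ∑-cong (suc (length r)) (λ x _ → total-tally p m k (x ∷ r))

count-tally : ∀ p n m → count p n m ≡ tally p m n 0 []
count-tally p n m = trans (count-total p n m) (total-tally p m n [])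

count-2-u01 : count 2-u01 7 4 ≡ 0
count-2-u01 = trans (count-tally 2-u01 7 4) refl

count-2-u10 : count 2-u10 7 4 ≡ 2
count-2-u10 = trans (count-tally 2-u10 7 4) refl

2-u01≁2-u10 : ¬ StronglyWilfEq 2-u01 2-u10
2-u01≁2-u10 h = contradiction (trans (sym count-2-u01) (trans (h 7 4) count-2-u10)) λ ()

1-u01≁1-u10 : ¬ SuperStronglyWilfEq 1-u01 1-u10
-- The prescribed set consists of the single triple of one-based positions 2, 4, 5, whose last two
-- are adjacent.
1-u01≁1-u10 h with () ← h 6 (λ where (i , j , k) → (i ≡ᵇ 1) ∧ (j ≡ᵇ 3) ∧ (k ≡ᵇ 4))

-- Absence of further equivalences.

_≟ˢ_ : (s t : Side) → Dec (s ≡ t)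
left  ≟ˢ left  = yes refl
left  ≟ˢ right = no λ ()
right ≟ˢ left  = no λ ()
right ≟ˢ right = yes refl

_≟ᴾ_ : (p q : HVPattern) → Dec (p ≡ q)
hvp a b c s ≟ᴾ hvp a′ b′ c′ s′ = map′ (λ { (refl , refl , refl , refl) → refl }) (λ { refl → refl , refl , refl , refl })
  ((a ≟ a′) ×-dec (b ≟ b′) ×-dec (c ≟ c′) ×-dec (s ≟ˢ s′))

samePair? : ∀ p q a b → Dec (SamePair p q a b)
samePair? p q a b = ((p ≟ᴾ a) ×-dec (q ≟ᴾ b)) ⊎-dec ((p ≟ᴾ b) ×-dec (q ≟ᴾ a))

Listed : HVPattern → HVPattern → Set
Listed p q = SamePair p q u01-0 u01-1 ⊎ SamePair p q u10-0 u10-1 ⊎ SamePair p q 1-u01 1-u10 ⊎ SamePair p q 2-u01 2-u10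

listed? : ∀ p q → Dec (Listed p q)
listed? p q = samePair? p q u01-0 u01-1 ⊎-dec samePair? p q u10-0 u10-1 ⊎-dec samePair? p q 1-u01 1-u10 ⊎-dec samePair? p q 2-u01 2-u10

separated : List ℕ → HVPattern → HVPattern → Bool
separated []       p q = false
separated (n ∷ ns) p q = not (avoiders p n [] ≡ᵇ avoiders q n []) ∨ separated ns p q

separated-sound : ∀ ns p q → WilfEq p q → separated ns p q ≡ false
separated-sound []       p q h = refl
separated-sound (n ∷ ns) p q h
  rewrite sym (count-avoiders p n) | sym (count-avoiders q n) | h n | ≡ᵇ-refl (count q n 0) = separated-sound ns p q h

-- The instances 0 and 1 of the condition in `Valid`, in a decidable form that filters the patterns
-- out of the 54 candidates.
Gapless : HVPattern → Set
Gapless p = (Appears 1 p → Appears 0 p) × (Appears 2 p → Appears 1 p)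

appears? : ∀ j p → Dec (Appears j p)
appears? j p = (p₁ p ≟ j) ⊎-dec (p₂ p ≟ j) ⊎-dec (p₃ p ≟ j)

gapless? : ∀ p → Dec (Gapless p)
gapless? p = (appears? 1 p →-dec appears? 0 p) ×-dec (appears? 2 p →-dec appears? 1 p)

candidates patterns : List HVPattern
candidates = cartesianProductWith (λ w s → w s)
  (cartesianProductWith (λ w c → w c) (cartesianProductWith hvp (upTo 3) (upTo 3)) (upTo 3)) (left ∷ right ∷ [])
patterns = filter gapless? candidates

valid⇒∈patterns : ∀ p → Valid p → p ∈ patterns
valid⇒∈patterns (hvp a b c s) ((a≤ , b≤ , c≤) , gapless) = ∈-filter⁺ gapless?
  (∈-cartesianProductWith⁺ (λ w s → w s)
    (∈-cartesianProductWith⁺ (λ w c → w c) (∈-cartesianProductWith⁺ hvp (∈-upTo⁺ (s≤s a≤)) (∈-upTo⁺ (s≤s b≤))) (∈-upTo⁺ (s≤s c≤)))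
    (∈-sides s))
  (gapless 0 , gapless 1)
  where
  ∈-sides : ∀ s → s ∈ left ∷ right ∷ []
  ∈-sides left  = here refl
  ∈-sides right = there (here refl)

allᵇ-sound : ∀ {A : Set} (f : A → Bool) xs {x} → allᵇ f xs ≡ true → x ∈ xs → f x ≡ true
allᵇ-sound f (y ∷ xs) h (here refl) = ∧-splitˡ h
allᵇ-sound f (y ∷ xs) h (there x∈)  = allᵇ-sound f xs (∧-splitʳ {f y} h) x∈

allᵇ²-sound : ∀ {A : Set} (f : A → A → Bool) xs {x y} →
  allᵇ (λ x → allᵇ (f x) xs) xs ≡ true → x ∈ xs → y ∈ xs → f x y ≡ true
allᵇ²-sound f xs {x} h x∈ y∈ = allᵇ-sound (f x) xs (allᵇ-sound (λ x → allᵇ (f x) xs) xs h x∈) y∈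

classified : HVPattern → HVPattern → Bool
classified p q = does (p ≟ᴾ q) ∨ does (listed? p q) ∨ separated (4 ∷ 5 ∷ 6 ∷ 7 ∷ []) p q

-- Evaluated for all ordered pairs of the 26 patterns: avoider numbers at lengths 4 to 7 separate
-- every pair of distinct patterns that is not listed.
all-classified : allᵇ (λ p → allᵇ (classified p) patterns) patterns ≡ true
all-classified = refl

only-listed : ∀ p q → Valid p → Valid q → p ≢ q → WilfEq p q → Listed p q
only-listed p q vp vq p≢q p~q = conclude (p ≟ᴾ q) (listed? p q)
  (allᵇ²-sound classified patterns all-classified (valid⇒∈patterns p vp) (valid⇒∈patterns q vq))
  where
  -- The decisions are taken as arguments so that matching on them reduces the Boolean disjunction.
  conclude : (d : Dec (p ≡ q)) (e : Dec (Listed p q)) → does d ∨ does e ∨ separated (4 ∷ 5 ∷ 6 ∷ 7 ∷ []) p q ≡ true → Listed p q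
  conclude (yes p≡q) _            _ = contradiction p≡q p≢q
  conclude (no _)    (yes listed) _ = listed
  conclude (no _)    (no _)       h = contradiction (trans (sym h) (separated-sound (4 ∷ 5 ∷ 6 ∷ 7 ∷ []) p q p~q)) λ ()

theorem2p1 : ((WilfEq u01-0 u01-1 × ¬ StronglyWilfEq u01-0 u01-1)
    × (WilfEq u10-0 u10-1 × ¬ StronglyWilfEq u10-0 u10-1)
    × (StronglyWilfEq 1-u01 1-u10 × ¬ SuperStronglyWilfEq 1-u01 1-u10)
    × (WilfEq 2-u01 2-u10 × ¬ StronglyWilfEq 2-u01 2-u10))
    × (∀ p q → Valid p → Valid q → p ≢ q → WilfEq p q →
    SamePair p q u01-0 u01-1 ⊎ SamePair p q u10-0 u10-1
    ⊎ SamePair p q 1-u01 1-u10 ⊎ SamePair p q 2-u01 2-u10)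
theorem2p1 =
  ( (u01-0~u01-1 , u01-0≁u01-1)
  , (u10-0~u10-1 , u10-0≁u10-1)
  , (1-u01~1-u10 , 1-u01≁1-u10)
  , (2-u01~2-u10 , 2-u01≁2-u10))
  , only-listed
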